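{- Let $q$ be a power of an odd prime with $q\equiv 3\pmod 4$, and let $k\equiv 0\pmod 4$ be a positive integer. Let $C_k=\{x\in\mathbb{F}_q^k : -x_1^2+x_2^2+\cdots+x_k^2=0\}$ and let $G_{Q,k}$ be the Cayley graph with vertex set $\mathbb{F}_q^k$ in which $x$ and $y$ are adjacent iff $x-y\in C_k$. Then its eigenvalues $\{\lambda_m\}_{m\in\mathbb{F}_q^k}$ are \[ \lambda_m=q^k\cdot\begin{cases} q^{ -1}\delta_0(m)-q^{ -\frac{k}{2}}+q^{ -\frac{k+2}{2}} & \text{if } m\in C_k,\\ q^{ -\frac{k+2}{2}} & \text{if } m\notin C_k.\end{cases}\]
   Context: Let $\chi$ be the principal (canonical) additive character of $\mathbb{F}_q$. The eigenvalue $\lambda_m$ of the Cayley graph is the one associated with the eigenvector $x\mapsto\chi(m\cdot x)$, namely $\lambda_m=\sum_{c\in C_k}\chi(-m\cdot c)$. $\delta_0(m)=1$ if $m=(0,\dots,0)$ and $\delta_0(m)=0$ otherwise. -}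

module Defs where

open import Algebra.Apartness.Bundles using (HeytingField; HeytingCommutativeRing)
open import Algebra.Bundles using (CommutativeRing; Semiring; RawSemiring)
open import Algebra.Core using (Op₁; Op₂)
open import Algebra.Definitions using (Invertible)
open import Algebra.Structures using (IsCommutativeRing)
import Algebra.Definitions.RawSemiring as RawSemiringDefinitions
open import Data.Bool.Base using (if_then_else_)
open import Data.Fin.Base using (Fin; toℕ)
open import Data.Fin.Properties using (inj⇒≟; nonZeroIndex)
open import Data.List.Base using (find; upTo)
open import Data.Maybe.Base using (fromMaybe)
open import Data.Nat.Base as ℕ using (ℕ; zero; suc; NonZero)
open import Data.Product.Base using (∃; _×_; proj₁)
open import Data.Vec.Base using (Vec; []; _∷_; zipWith; replicate; foldr′)
open import Data.Vec.Properties using (≡-dec)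
open import Function.Bundles using (_↔_; Inverse)
open import Function.Properties.Inverse using (↔⇒↣)
open import Level using (Level; _⊔_) renaming (suc to lsuc)
open import Relation.Binary.Core using (Rel)
open import Relation.Binary.Definitions using (Decidable; DecidableEquality)
open import Relation.Binary.PropositionalEquality.Core using (_≡_; _≢_)
open import Relation.Nullary.Decidable.Core using (does)
import Relation.Unary as Unary

record FiniteField (f : Level) (q : ℕ) : Set (lsuc f) where
  infix  8 -_
  infixl 7 _*_
  infixl 6 _+_
  field
    Carrier           : Set f
    _+_ _*_           : Op₂ Carrier
    -_                : Op₁ Carrier
    0# 1#             : Carrier
    isCommutativeRing : IsCommutativeRing _≡_ _+_ _*_ -_ 0# 1#
    0≢1               : 0# ≢ 1#
    invertible        : ∀ x → x ≢ 0# → Invertible _≡_ 1# _*_ x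
    enumeration       : Carrier ↔ Fin q

  commutativeRing : CommutativeRing f f
  commutativeRing = record { isCommutativeRing = isCommutativeRing }

  open CommutativeRing commutativeRing public using (_-_; semiring)
  open RawSemiringDefinitions (Semiring.rawSemiring semiring) public
    using (sum; _^_) renaming (_×_ to _·_)

  _≟_ : DecidableEquality Carrier
  _≟_ = inj⇒≟ (↔⇒↣ enumeration)

  element : Fin q → Carrier
  element = Inverse.from enumeration

  size-nonZero : NonZero q
  size-nonZero = nonZeroIndex (Inverse.to enumeration 0#)

module HeytingFieldArithmetic {c ℓ₁ ℓ₂} (K : HeytingField c ℓ₁ ℓ₂) where
  open HeytingField K public
  open CommutativeRing (HeytingCommutativeRing.commutativeRing heytingCommutativeRing)
    using (semiring)
  open RawSemiringDefinitions (Semiring.rawSemiring semiring) public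
    using (sum; _^_) renaming (_×_ to _·_)

  reciprocal : ∀ x → x # 0# → Carrier
  reciprocal x x#0 = proj₁ (#⇒invertible x#0)

  CharacteristicZero : Set ℓ₂
  CharacteristicZero = ∀ n → .{{NonZero n}} → n · 1# # 0#

  IsPrimitiveRootOfUnity : ℕ → Carrier → Set (ℓ₁ ⊔ ℓ₂)
  IsPrimitiveRootOfUnity n ζ =
    ζ ^ n ≈ 1# × (∀ j → 0 ℕ.< j → j ℕ.< n → ζ ^ j # 1#)

open HeytingFieldArithmetic public using (CharacteristicZero; IsPrimitiveRootOfUnity)

module Space {f q} (F : FiniteField f q) (k : ℕ) where
  open FiniteField F

  V : Set f
  V = Vec Carrier k

  infixl 6 _⊖_
  infixl 7 _∙_

  _⊖_ : V → V → V
  _⊖_ = zipWith _-_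

  _∙_ : V → V → Carrier
  x ∙ y = foldr′ _+_ 0# (zipWith _*_ x y)

  origin : V
  origin = replicate k 0#

  _≟ᵛ_ : DecidableEquality V
  _≟ᵛ_ = ≡-dec _≟_

-- Q(x) = - x₁² + x₂² + ⋯ + xₖ²; the value for k = 0 is a convention that is
-- not used.
module Quadric {f q} (F : FiniteField f q) where
  open FiniteField F

  Q : ∀ {k} → Vec Carrier k → Carrier
  Q []                   = 0#
  Q {k = suc k} (x ∷ xs) = - (x * x) + xs ∙ xs
    where open Space F k

  C : ∀ k → Unary.Pred (Vec Carrier k) f
  C k x = Q x ≡ 0#

  C? : ∀ k → Unary.Decidable (C k)
  C? k x = Q x ≟ 0#

-- For S = - S this is an undirected graph; it has a loop at every vertex
-- exactly when S contains the origin.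
module CayleyGraph {f q} (F : FiniteField f q) (k : ℕ)
                   {s} (S : Unary.Pred (Space.V F k) s) (S? : Unary.Decidable S) where
  open Space F k

  Adjacent : Rel V s
  Adjacent x y = S (x ⊖ y)

  adjacent? : Decidable Adjacent
  adjacent? x y = S? (x ⊖ y)

module FunctionSpace {c ℓ₁ ℓ₂} (K : HeytingField c ℓ₁ ℓ₂)
                     {f q} (F : FiniteField f q) (k : ℕ) where
  open HeytingFieldArithmetic K
  private module F = FiniteField F
  open Space F k using (V)

  sumVectors : ∀ {j} → (Vec F.Carrier j → Carrier) → Carrier
  sumVectors {zero}  g = g []
  sumVectors {suc j} g = sum λ i → sumVectors λ xs → g (F.element i ∷ xs)

  sumOver : ∀ {s} {S : Unary.Pred V s} → Unary.Decidable S → (V → Carrier) → Carrier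
  sumOver S? g = sumVectors λ x → if does (S? x) then g x else 0#

  adjacencyOperator : ∀ {r} {R : Rel V r} → Decidable R →
                      (V → Carrier) → (V → Carrier)
  adjacencyOperator R? g x = sumOver (R? x) g

  IsEigenvector : ((V → Carrier) → (V → Carrier)) → Carrier → (V → Carrier) → Set _
  IsEigenvector T μ g = (∃ λ x → g x # 0#) × (∀ x → T g x ≈ μ * g x)

  IsExpansion : (V → V → Carrier) → (V → Carrier) → (V → Carrier) → Set _
  IsExpansion e a g = ∀ x → g x ≈ sumVectors λ m → a m * e m x

  IsBasis : (V → V → Carrier) → Set _
  IsBasis e = ∀ g → ∃ λ a → IsExpansion e a g ×
                            (∀ b → IsExpansion e b g → ∀ m → a m ≈ b m)

-- With q = p ^ n, where p is the characteristic of F.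
module CanonicalCharacter {c ℓ₁ ℓ₂} (K : HeytingField c ℓ₁ ℓ₂) (ζ : HeytingField.Carrier K)
                          {f q} (F : FiniteField f q) (p n : ℕ) where
  open HeytingFieldArithmetic K using (Carrier) renaming (_^_ to _^ᴷ_)
  private module F = FiniteField F

  Tr : F.Carrier → F.Carrier
  Tr x = F.sum {n} λ i → x F.^ (p ℕ.^ toℕ i)

  -- The t < p with t · 1 ≡ y. The default 0 is only reached outside the prime
  -- subfield, in which all traces lie.
  residue : F.Carrier → ℕ
  residue y = fromMaybe 0 (find (λ t → (t F.· F.1#) F.≟ y) (upTo p))

  -- K = ℂ and ζ = exp (2πi / p) give the principal character
  -- x ↦ exp (2πi Tr(x) / p).
  χ : F.Carrier → Carrier
  χ x = ζ ^ᴷ residue (Tr x)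

module Spectrum {c ℓ₁ ℓ₂} (K : HeytingField c ℓ₁ ℓ₂) (charZero : CharacteristicZero K)
                (ζ : HeytingField.Carrier K)
                {f q} (F : FiniteField f q) (p n k : ℕ) where
  open HeytingFieldArithmetic K public
    using (_≈_; _+_; _*_; _-_; _^_)
  open HeytingFieldArithmetic K using (Carrier; 0#; 1#; _·_; reciprocal)
  private module F = FiniteField F
  open Space F k public using (V)
  open Space F k using (_∙_; origin; _≟ᵛ_)
  open CanonicalCharacter K ζ F p n using (χ)
  open FunctionSpace K F k public using (IsEigenvector; IsBasis)
  open FunctionSpace K F k using (sumOver; adjacencyOperator)

  Cₖ : Unary.Pred V f
  Cₖ = Quadric.C F k

  Cₖ? : Unary.Decidable Cₖ
  Cₖ? = Quadric.C? F k

  adjacency : (V → Carrier) → (V → Carrier)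
  adjacency = adjacencyOperator (CayleyGraph.adjacent? F k Cₖ Cₖ?)

  character : V → V → Carrier
  character m x = χ (m ∙ x)

  -- If the characters form a basis of eigenvectors, this family is the whole
  -- spectrum, counted with multiplicity.
  eigenvalue : V → Carrier
  eigenvalue m = sumOver Cₖ? λ c → χ (F.- (m ∙ c))

  δ₀ : V → Carrier
  δ₀ m = if does (m ≟ᵛ origin) then 1# else 0#

  qᴷ : Carrier
  qᴷ = q · 1#

  q⁻¹ : Carrier
  q⁻¹ = reciprocal qᴷ (charZero q {{F.size-nonZero}})

{-# OPTIONS --safe #-}
module Submission where

open import Defs
open import Algebra.Apartness.Bundles using (HeytingField; HeytingCommutativeRing)
import Algebra.Apartness.Properties.HeytingCommutativeRing as HeytingProperties
open import Algebra.Bundles using (CommutativeMonoid; CommutativeRing)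
import Algebra.Properties.CommutativeMonoid.Sum as MonoidSum
import Algebra.Properties.CommutativeSemiring.Binomial as Binomial
import Algebra.Properties.CommutativeSemiring.Exp as Exp
import Algebra.Properties.Ring as RingProperties
import Algebra.Properties.Semiring.Mult as SemiringMult
import Algebra.Properties.Semiring.Mult.TCOptimised as Mult
import Algebra.Properties.Semiring.Sum as SemiringSum
import Algebra.Solver.Ring as RingSolver
open import Algebra.Solver.Ring.AlmostCommutativeRing using (fromCommutativeRing; _-Raw-AlmostCommutative⟶_)
open import Data.Bool.Base using (if_then_else_)
open import Data.Fin.Base using (Fin; zero; suc; toℕ; fromℕ; inject≤)
open import Data.Fin.Permutation using (Permutation′; permutation)
open import Data.Fin.Properties
  using (any?; injective⇒≤; punchOut-injective; toℕ<n; toℕ-fromℕ; toℕ-injective; inject≤-injective)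
  renaming (_≟_ to _≟ᶠ_; suc-injective to sucᶠ-injective)
open import Data.Integer.Base as ℤ using (ℤ; -[1+_]; _◃_; sign; ∣_∣)
import Data.Integer.Properties as ℤ
open import Data.List.Base using (List; find)
open import Data.List.Membership.Propositional using (lose)
open import Data.List.Membership.Propositional.Properties using (∈-upTo⁺)
open import Data.List.Relation.Unary.Any using (Any; here; there)
open import Data.Maybe.Base as Maybe using (just; fromMaybe)
open import Data.Nat.Base as ℕ using (ℕ; zero; suc; _∸_; _!; NonZero; s≤s; z<s)
open import Data.Nat.Combinatorics using (_C_; nCn≡1; k![n∸k]!∣n!)
open import Data.Nat.Combinatorics.Specification using (nCk≡n!/k![n-k]!)
open import Data.Nat.Coprimality using (prime⇒coprime; coprime-Bézout)
open import Data.Nat.Divisibility using (_∣_; divides; ∣⇒≤; m∣m*n)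
open import Data.Nat.DivMod using (_/_; _%_; m/n*n≡m; m*n/n≡m; m≡m%n+[m/n]*n; m%n<n)
open import Data.Nat.GCD using (module Bézout)
open import Data.Nat.Primality using (Prime; euclidsLemma; prime⇒nonZero; prime⇒nonTrivial)
import Data.Nat.Properties as ℕ
open import Data.Nat.Properties using (_!*_!≢0)
open import Data.Product.Base using (∃; _×_; _,_; proj₁; proj₂)
open import Data.Sign.Base as Sign using (Sign)
open import Data.Sum.Base using (_⊎_; inj₁; inj₂; [_,_]′)
open import Data.Vec.Base using (Vec; []; _∷_; replicate)
open import Data.Vec.Properties using (∷-injective)
open import Function.Base using (_∘_; id)
open import Function.Bundles using (_↔_; Inverse)
open import Function.Definitions using (Injective)
open import Level using (_⊔_)
open import Relation.Binary.Consequences using (dec⇒weaklyDec)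
open import Relation.Binary.Definitions using (WeaklyDecidable)
open import Relation.Binary.PropositionalEquality as ≡ using (_≡_; _≢_)
import Relation.Binary.Reasoning.Setoid as SetoidReasoning
open import Relation.Nullary using (¬_; ¬?; Dec; yes; no; does; contradiction; decidable-stable)
open import Relation.Unary using (Pred; Decidable)

-- Detecting the equation Q x = 0 by the character sum Σ_s χ(s Q x) turns q λ_m
-- into Σ_s Σ_x χ(s Q x - m · x). The term s = 0 is q^k δ₀(m). For s ≢ 0,
-- completing the square in each coordinate leaves χ(- Q m / 4s) G(- s) G(s)^(k-1),
-- where G(s) = Σ_x χ(s x²). When q ≡ 3 (mod 4), - 1 is not a square, so
-- x ↦ η(x) x², η the quadratic character, permutes 𝔽_q and G(s) + G(- s) = 0.
-- Together with G(s) G(- s) = q this gives G(s)² = - q, hence for 4 ∣ k the term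
-- is - q^(k/2) χ(- Q m / 4s); summing over s ≢ 0 gives - q^(k/2) (q [Q m = 0] - 1).

-- The scalars form a Heyting field: a factor cancels only if it is known to be apart from zero, and
-- equality of scalars cannot be decided. Hence nontriviality of a character is recorded as an
-- apartness `χ a # 1#`, every case distinction is made in the finite field, and the sign of a Gauss
-- sum stays undetermined. Much of the field theory serves to show that the canonical character is a
-- nontrivial character at all. Its exponent is meaningful because traces lie in the prime subfield;
-- it is nontrivial because the trace, a polynomial of degree p^(n-1) < q, cannot vanish on the
-- whole field. The range s ≢ 0 is awkward to reindex. With 1/0 read as 0, inversion permutes the
-- whole field, and a correction added to every summand, s = 0 included, leaves only full sums.

-- A ring solver with integer coefficients, so that cancellation is detected
-- in rings without decidable equality.
module IntegerCoefficients {c ℓ} (R : CommutativeRing c ℓ) where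
  open CommutativeRing R
  open RingProperties ring
  open Mult semiring using (×-homo-+; ×1-homo-*) renaming (_×_ to _·_)
  open SetoidReasoning setoid

  -- With the optimised multiples, `1 · 1#` computes to `1#`, so that the constants 0 and 1 of the
  -- solver are `0#` and `1#` by computation.
  ⟦_⟧ : ℤ → Carrier
  ⟦ ℤ.+ n ⟧      = n · 1#
  ⟦ -[1+ n ] ⟧ = - (suc n · 1#)

  ⟦_⟧ˢ : Sign → Carrier
  ⟦ Sign.+ ⟧ˢ = 1#
  ⟦ Sign.- ⟧ˢ = - 1#

  suc-cancel : ∀ a b → (1# + a) - (1# + b) ≈ a - b
  suc-cancel a b = begin
    (1# + a) - (1# + b)         ≈⟨ +-cong (+-comm 1# a) (sym (-‿+-comm 1# b)) ⟩
    (a + 1#) + (- 1# + - b)     ≈⟨ +-assoc a 1# _ ⟩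
    a + (1# + (- 1# + - b))     ≈⟨ +-congˡ (+-assoc 1# (- 1#) (- b)) ⟨
    a + ((1# + - 1#) + - b)     ≈⟨ +-congˡ (+-congʳ (-‿inverseʳ 1#)) ⟩
    a + (0# + - b)              ≈⟨ +-congˡ (+-identityˡ (- b)) ⟩
    a - b                       ∎

  ⊖-homo : ∀ m n → ⟦ m ℤ.⊖ n ⟧ ≈ m · 1# - n · 1#
  ⊖-homo m       zero    = sym (trans (+-congˡ -0#≈0#) (+-identityʳ _))
  ⊖-homo zero    (suc n) = sym (+-identityˡ _)
  ⊖-homo (suc m) (suc n) = begin
    ⟦ suc m ℤ.⊖ suc n ⟧               ≡⟨ ≡.cong ⟦_⟧ (ℤ.[1+m]⊖[1+n]≡m⊖n m n) ⟩
    ⟦ m ℤ.⊖ n ⟧                       ≈⟨ ⊖-homo m n ⟩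
    m · 1# - n · 1#                 ≈⟨ suc-cancel (m · 1#) (n · 1#) ⟨
    (1# + m · 1#) - (1# + n · 1#)   ≈⟨ +-cong (×-homo-+ 1# 1 m) (-‿cong (×-homo-+ 1# 1 n)) ⟨
    suc m · 1# - suc n · 1#         ∎

  +-homo : ∀ i j → ⟦ i ℤ.+ j ⟧ ≈ ⟦ i ⟧ + ⟦ j ⟧
  +-homo (ℤ.+ m)    (ℤ.+ n)    = ×-homo-+ 1# m n
  +-homo (ℤ.+ m)    -[1+ n ] = ⊖-homo m (suc n)
  +-homo -[1+ m ] (ℤ.+ n)    = trans (⊖-homo n (suc m)) (+-comm _ _)
  +-homo -[1+ m ] -[1+ n ] = begin
    - (suc (suc (m ℕ.+ n)) · 1#)        ≡⟨ ≡.cong (λ k → - (k · 1#)) (ℕ.+-suc (suc m) n) ⟨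
    - ((suc m ℕ.+ suc n) · 1#)          ≈⟨ -‿cong (×-homo-+ 1# (suc m) (suc n)) ⟩
    - (suc m · 1# + suc n · 1#)         ≈⟨ -‿+-comm _ _ ⟨
    - (suc m · 1#) + - (suc n · 1#)     ∎

  ◃-homo : ∀ s n → ⟦ s ◃ n ⟧ ≈ ⟦ s ⟧ˢ * (n · 1#)
  ◃-homo s      zero    = sym (zeroʳ _)
  ◃-homo Sign.+ (suc n) = sym (*-identityˡ _)
  ◃-homo Sign.- (suc n) = sym (-1*x≈-x _)

  ⟦⟧≈sign*abs : ∀ i → ⟦ i ⟧ ≈ ⟦ sign i ⟧ˢ * (∣ i ∣ · 1#)
  ⟦⟧≈sign*abs (ℤ.+ n)    = sym (*-identityˡ _)
  ⟦⟧≈sign*abs -[1+ n ] = sym (-1*x≈-x _)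

  sign-homo : ∀ s t → ⟦ s Sign.* t ⟧ˢ ≈ ⟦ s ⟧ˢ * ⟦ t ⟧ˢ
  sign-homo Sign.+ t      = sym (*-identityˡ _)
  sign-homo Sign.- Sign.+ = sym (*-identityʳ _)
  sign-homo Sign.- Sign.- = sym (trans (-1*x≈-x _) (-‿involutive 1#))

  *-homo : ∀ i j → ⟦ i ℤ.* j ⟧ ≈ ⟦ i ⟧ * ⟦ j ⟧
  *-homo i j = begin
    ⟦ sign i Sign.* sign j ◃ ∣ i ∣ ℕ.* ∣ j ∣ ⟧
      ≈⟨ ◃-homo (sign i Sign.* sign j) (∣ i ∣ ℕ.* ∣ j ∣) ⟩
    ⟦ sign i Sign.* sign j ⟧ˢ * ((∣ i ∣ ℕ.* ∣ j ∣) · 1#)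
      ≈⟨ *-cong (sign-homo (sign i) (sign j)) (×1-homo-* ∣ i ∣ ∣ j ∣) ⟩
    (s * t) * (a * b)
      ≈⟨ *-assoc s t (a * b) ⟩
    s * (t * (a * b))
      ≈⟨ *-congˡ (*-assoc t a b) ⟨
    s * ((t * a) * b)
      ≈⟨ *-congˡ (*-congʳ (*-comm t a)) ⟩
    s * ((a * t) * b)
      ≈⟨ *-congˡ (*-assoc a t b) ⟩
    s * (a * (t * b))
      ≈⟨ *-assoc s a (t * b) ⟨
    (s * a) * (t * b)
      ≈⟨ *-cong (⟦⟧≈sign*abs i) (⟦⟧≈sign*abs j) ⟨
    ⟦ i ⟧ * ⟦ j ⟧
      ∎
    where
    s = ⟦ sign i ⟧ˢ
    t = ⟦ sign j ⟧ˢ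
    a = ∣ i ∣ · 1#
    b = ∣ j ∣ · 1#

  -‿homo : ∀ i → ⟦ ℤ.- i ⟧ ≈ - ⟦ i ⟧
  -‿homo (ℤ.+ zero)  = sym -0#≈0#
  -‿homo (ℤ.+ suc n) = refl
  -‿homo -[1+ n ]  = sym (-‿involutive _)

  morphism : ℤ.+-*-rawRing -Raw-AlmostCommutative⟶ fromCommutativeRing R
  morphism = record
    { ⟦_⟧ = ⟦_⟧ ; +-homo = +-homo ; *-homo = *-homo ; -‿homo = -‿homo
    ; 0-homo = refl ; 1-homo = refl }

  _coeff≟_ : WeaklyDecidable (λ i j → ⟦ i ⟧ ≈ ⟦ j ⟧)
  i coeff≟ j = Maybe.map (reflexive ∘ ≡.cong ⟦_⟧) (dec⇒weaklyDec ℤ._≟_ i j)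

  open RingSolver ℤ.+-*-rawRing (fromCommutativeRing R) morphism _coeff≟_ public
    using (Polynomial; solve; _:=_; _:+_; _:*_; _:-_; :-_; con)

-- Finite sets and sums indexed by them

injective⇒surjective : ∀ {n} {f : Fin n → Fin n} → Injective _≡_ _≡_ f → ∀ j → ∃ λ i → f i ≡ j
injective⇒surjective {suc n} {f} f-injective j with any? (λ i → f i ≟ᶠ j)
... | yes hit = hit
-- Deleting the missed value `j` from the codomain would inject `Fin (suc n)` into `Fin n`.
... | no miss = contradiction
  (injective⇒≤ λ eq → f-injective (punchOut-injective (j≢f _) (j≢f _) eq)) ℕ.1+n≰n
  where
  j≢f : ∀ i → j ≢ f i
  j≢f i j≡fi = miss (i , ≡.sym j≡fi)

injective⇒permutation : ∀ {n} (f : Fin n → Fin n) → Injective _≡_ _≡_ f → Permutation′ n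
injective⇒permutation f f-injective =
  permutation f (proj₁ ∘ preimage) (proj₂ ∘ preimage)
    (λ i → f-injective (proj₂ (preimage (f i))))
  where
  preimage = injective⇒surjective f-injective

-- The monoid is arbitrary because the same facts serve for sums in the finite field, for products
-- in it and for sums of scalars.
module SumsOver {c ℓ} (M : CommutativeMonoid c ℓ) {a} {A : Set a} {q} (enumeration : A ↔ Fin q) where
  open CommutativeMonoid M
    renaming (_∙_ to _+_; ε to 0#; identityˡ to +-identityˡ; identityʳ to +-identityʳ;
              ∙-cong to +-cong; ∙-congˡ to +-congˡ)
  open MonoidSum M
  open Inverse enumeration using (to; from; strictlyInverseˡ; strictlyInverseʳ)

  sum-zero : ∀ {n} {t : Fin n → Carrier} → (∀ j → t j ≈ 0#) → sum t ≈ 0#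
  sum-zero {n} t≈0 = trans (sum-cong-≋ t≈0) (sum-replicate-zero n)

  sum-single : ∀ {n} {t : Fin n → Carrier} i → (∀ j → j ≢ i → t j ≈ 0#) → sum t ≈ t i
  sum-single zero    t≈0 =
    trans (+-congˡ (sum-zero λ j → t≈0 (suc j) λ ())) (+-identityʳ _)
  sum-single (suc i) t≈0 =
    trans (+-cong (t≈0 zero λ ()) (sum-single i λ j j≢i → t≈0 (suc j) (j≢i ∘ sucᶠ-injective)))
          (+-identityˡ _)

  Σ : (A → Carrier) → Carrier
  Σ g = sum (g ∘ from)

  Σ-cong : ∀ {g h} → (∀ x → g x ≈ h x) → Σ g ≈ Σ h
  Σ-cong g≈h = sum-cong-≋ (g≈h ∘ from)

  Σ-distrib-+ : ∀ g h → Σ (λ x → g x + h x) ≈ Σ g + Σ h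
  Σ-distrib-+ g h = ∑-distrib-+ (g ∘ from) (h ∘ from)

  Σ-single : ∀ {g} a → (∀ x → x ≢ a → g x ≈ 0#) → Σ g ≈ g a
  Σ-single {g} a g≈0 = trans
    (sum-single (to a) λ j j≢a → g≈0 (from j) λ fj≡a →
      j≢a (≡.trans (≡.sym (strictlyInverseˡ j)) (≡.cong to fj≡a)))
    (reflexive (≡.cong g (strictlyInverseʳ a)))

  -- On a finite type an injection is a permutation, so a cancellation law is all that a change of
  -- variable has to supply.
  Σ-reindex : ∀ g (f : A → A) → Injective _≡_ _≡_ f → Σ (g ∘ f) ≈ Σ g
  Σ-reindex g f f-injective = sym (trans (sum-permute (g ∘ from) π)
    (reflexive (sum-cong-≗ λ i → ≡.cong g (strictlyInverseʳ (f (from i))))))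
    where
    to-injective : Injective _≡_ _≡_ to
    to-injective eq = ≡.trans (≡.sym (strictlyInverseʳ _)) (≡.trans (≡.cong from eq) (strictlyInverseʳ _))
    from-injective : Injective _≡_ _≡_ from
    from-injective eq = ≡.trans (≡.sym (strictlyInverseˡ _)) (≡.trans (≡.cong to eq) (strictlyInverseˡ _))
    π = injective⇒permutation (to ∘ f ∘ from) (from-injective ∘ f-injective ∘ to-injective)

-- Binomial coefficients modulo a prime

p∤m! : ∀ {p} m → Prime p → m ℕ.< p → ¬ (p ∣ m !)
p∤m! zero    p-prime 1<p p∣m! = ℕ.<⇒≱ (ℕ.nonTrivial⇒n>1 _ {{prime⇒nonTrivial p-prime}}) (∣⇒≤ p∣m!)
p∤m! (suc m) p-prime m<p p∣m! with euclidsLemma (suc m) (m !) p-prime p∣m!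
... | inj₁ p∣1+m = ℕ.<⇒≱ m<p (∣⇒≤ p∣1+m)
... | inj₂ p∣m!′ = p∤m! m p-prime (ℕ.<-trans (ℕ.n<1+n m) m<p) p∣m!′

p∣p! : ∀ {p} → Prime p → p ∣ p !
p∣p! {suc p} _ = m∣m*n (p !)
p∣p! {zero} p-prime = contradiction ≡.refl (ℕ.≢-nonZero⁻¹ 0 {{prime⇒nonZero p-prime}})

nCk*k![n-k]!≡n! : ∀ {n k} → k ℕ.≤ n → (n C k) ℕ.* (k ! ℕ.* (n ∸ k) !) ≡ n !
nCk*k![n-k]!≡n! {n} {k} k≤n = ≡.trans
  (≡.cong (ℕ._* (k ! ℕ.* (n ∸ k) !)) (nCk≡n!/k![n-k]! k≤n))
  (m/n*n≡m {{k !* (n ∸ k) !≢0}} (k![n∸k]!∣n! k≤n))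

-- The prime divides `p !`, the product of `p C k` and two factorials of numbers below `p`, and by
-- Euclid's lemma it divides neither factorial.
p∣pCk : ∀ {p k} → Prime p → 0 ℕ.< k → k ℕ.< p → p ∣ p C k
p∣pCk {p} {k} p-prime 0<k k<p
  with euclidsLemma (p C k) (k ! ℕ.* (p ∸ k) !) p-prime
         (≡.subst (p ∣_) (≡.sym (nCk*k![n-k]!≡n! (ℕ.<⇒≤ k<p))) (p∣p! p-prime))
... | inj₁ p∣pCk = p∣pCk
... | inj₂ p∣k![p-k]! with euclidsLemma (k !) ((p ∸ k) !) p-prime p∣k![p-k]!
...   | inj₁ p∣k! = contradiction p∣k! (p∤m! k p-prime k<p)
...   | inj₂ p∣[p-k]! = contradiction p∣[p-k]! (p∤m! (p ∸ k) p-prime (ℕ.∸-monoʳ-< 0<k (ℕ.<⇒≤ k<p)))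

-- Finite fields: inverses, the identity x^q = x, root counting

module FieldTheory {f q} (F : FiniteField f q) where
  open ≡ using (refl; sym; trans; cong; cong₂)
  open ≡.≡-Reasoning
  open FiniteField F public
  open CommutativeRing commutativeRing public
    using (+-assoc; +-comm; +-identityˡ; +-identityʳ; -‿inverseˡ; -‿inverseʳ;
           *-assoc; *-comm; *-identityˡ; *-identityʳ; zeroˡ; zeroʳ; ring;
           +-commutativeMonoid; *-commutativeMonoid; commutativeSemiring)
  open RingProperties ring public
    using (-0#≈0#; -‿distribˡ-*; -‿involutive; -‿injective; +-cancelˡ; +-cancelʳ)
  open SemiringMult semiring public
    using (×-homo-+; ×-homo-1; ×1-homo-*; ×-assocˡ; ×-assoc-*)
  open Exp commutativeSemiring public using (^-assocʳ; ^-distrib-*)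
  open IntegerCoefficients commutativeRing public using (Polynomial; solve; _:=_; _:+_; _:*_; _:-_; :-_; con)

  module Sum = SumsOver +-commutativeMonoid enumeration
  module Product = SumsOver *-commutativeMonoid enumeration
  module SumProperties = MonoidSum +-commutativeMonoid

  x-y≡0⇒x≡y : ∀ {x y} → x - y ≡ 0# → x ≡ y
  x-y≡0⇒x≡y {x} {y} x-y≡0 = begin
    x           ≡⟨ solve 2 (λ x y → x := (x :- y) :+ y) refl x y ⟩
    (x - y) + y ≡⟨ cong (_+ y) x-y≡0 ⟩
    0# + y      ≡⟨ +-identityˡ y ⟩
    y           ∎

  -- Made total by `inv 0# = 0#`, so that it is an involution of the whole field and sums over the
  -- field can be reindexed by it.
  inv : Carrier → Carrier
  inv x with x ≟ 0#
  ... | yes _  = 0#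
  ... | no x≢0 = proj₁ (invertible x x≢0)

  inv-inverseʳ : ∀ {x} → x ≢ 0# → x * inv x ≡ 1#
  inv-inverseʳ {x} x≢0 with x ≟ 0#
  ... | yes x≡0 = contradiction x≡0 x≢0
  ... | no x≢0′ = proj₂ (proj₂ (invertible x x≢0′))

  *-cancelˡ : ∀ {a x y} → a ≢ 0# → a * x ≡ a * y → x ≡ y
  *-cancelˡ {a} {x} {y} a≢0 ax≡ay = begin
    x               ≡⟨ expand x ⟨
    inv a * (a * x) ≡⟨ cong (inv a *_) ax≡ay ⟩
    inv a * (a * y) ≡⟨ expand y ⟩
    y               ∎
    where
    expand : ∀ z → inv a * (a * z) ≡ z
    expand z = begin
      inv a * (a * z) ≡⟨ solve 3 (λ i a z → i :* (a :* z) := (a :* i) :* z) refl (inv a) a z ⟩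
      (a * inv a) * z ≡⟨ cong (_* z) (inv-inverseʳ a≢0) ⟩
      1# * z          ≡⟨ *-identityˡ z ⟩
      z               ∎

  x*y≡0⇒x≡0∨y≡0 : ∀ {x y} → x * y ≡ 0# → x ≡ 0# ⊎ y ≡ 0#
  x*y≡0⇒x≡0∨y≡0 {x} xy≡0 with x ≟ 0#
  ... | yes x≡0 = inj₁ x≡0
  ... | no  x≢0 = inj₂ (*-cancelˡ x≢0 (trans xy≡0 (sym (zeroʳ x))))

  x*y≢0 : ∀ {x y} → x ≢ 0# → y ≢ 0# → x * y ≢ 0#
  x*y≢0 x≢0 y≢0 = [ x≢0 , y≢0 ]′ ∘ x*y≡0⇒x≡0∨y≡0

  inv-0 : inv 0# ≡ 0#
  inv-0 with 0# ≟ 0#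
  ... | yes _  = refl
  ... | no 0≢0 = contradiction refl 0≢0

  inv-involutive : ∀ x → inv (inv x) ≡ x
  inv-involutive x with x ≟ 0#
  ... | yes x≡0 = trans inv-0 (sym x≡0)
  ... | no  x≢0 = *-cancelˡ y≢0 (trans (inv-inverseʳ y≢0) (trans (sym xy≡1) (*-comm x y)))
    where
    y = proj₁ (invertible x x≢0)
    xy≡1 : x * y ≡ 1#
    xy≡1 = proj₂ (proj₂ (invertible x x≢0))
    y≢0 : y ≢ 0#
    y≢0 y≡0 = 0≢1 (trans (sym (zeroʳ x)) (trans (cong (x *_) (sym y≡0)) xy≡1))

  inv-injective : Injective _≡_ _≡_ inv
  inv-injective {x} {y} eq = trans (sym (inv-involutive x)) (trans (cong inv eq) (inv-involutive y))

  x^n≡0⇒x≡0 : ∀ {x} n → x ^ n ≡ 0# → x ≡ 0#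
  x^n≡0⇒x≡0 zero    1≡0 = contradiction (sym 1≡0) 0≢1
  x^n≡0⇒x≡0 (suc n) eq = [ id , x^n≡0⇒x≡0 n ]′ (x*y≡0⇒x≡0∨y≡0 eq)

  -- Translation by `1#` permutes the field, so the sum of all elements does not change when `1#` is
  -- added to each of the `q` summands.
  size·1≡0 : q · 1# ≡ 0#
  size·1≡0 = sym (+-cancelˡ S 0# (q · 1#) (begin
    S + 0#              ≡⟨ +-identityʳ S ⟩
    S                   ≡⟨ Sum.Σ-reindex (λ x → x) (_+ 1#) (λ {x} {y} → +-cancelʳ 1# x y) ⟨
    Sum.Σ (_+ 1#)       ≡⟨ Sum.Σ-distrib-+ (λ x → x) (λ _ → 1#) ⟩
    S + Sum.Σ (λ _ → 1#) ≡⟨ cong (S +_) (SumProperties.sum-replicate q) ⟩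
    S + q · 1#          ∎))
    where S = Sum.Σ λ x → x

  product≢0 : ∀ {n} {t : Fin n → Carrier} → (∀ i → t i ≢ 0#) → MonoidSum.sum *-commutativeMonoid t ≢ 0#
  product≢0 {zero}  t≢0 1≡0 = 0≢1 (sym 1≡0)
  product≢0 {suc n} t≢0 = x*y≢0 (t≢0 zero) (product≢0 (t≢0 ∘ suc))

  -- Multiplication by a ≢ 0 permutes the factors of P = ∏ z x, the product of
  -- the nonzero elements. The zero element contributes no factor a; the
  -- product over d makes up for it.
  x^q≡x : ∀ a → a ^ q ≡ a
  x^q≡x a with a ≟ 0#
  ... | yes refl = 0^q≡0 size-nonZero
    where
    0^q≡0 : ∀ {n} → NonZero n → 0# ^ n ≡ 0#
    0^q≡0 {suc n} _ = zeroˡ _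
  ... | no a≢0 = *-cancelˡ P≢0 (begin
    P * a ^ q                             ≡⟨ cong (P *_) (MonoidSum.sum-replicate *-commutativeMonoid q) ⟨
    P * Product.Σ (λ _ → a)               ≡⟨ cong (P *_) (Product.Σ-cong λ x → c*d≡a (x ≟ 0#)) ⟨
    P * Product.Σ (λ x → c x * d x)       ≡⟨ cong (P *_) (Product.Σ-distrib-+ c d) ⟩
    P * (Product.Σ c * Product.Σ d)       ≡⟨ cong (λ y → P * (Product.Σ c * y))
                                                  (Product.Σ-single 0# λ x → d≡1 (x ≟ 0#)) ⟩
    P * (Product.Σ c * d 0#)              ≡⟨ cong (λ y → P * (Product.Σ c * y)) (d0≡a (0# ≟ 0#)) ⟩
    P * (Product.Σ c * a)                 ≡⟨ solve 3 (λ P c a → P :* (c :* a) := (c :* P) :* a) refl P _ a ⟩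
    (Product.Σ c * P) * a                 ≡⟨ cong (_* a) (Product.Σ-distrib-+ c z) ⟨
    Product.Σ (λ x → c x * z x) * a       ≡⟨ cong (_* a) (Product.Σ-cong λ x → z[ax]≡cz ((a * x) ≟ 0#) (x ≟ 0#)) ⟨
    Product.Σ (λ x → z (a * x)) * a       ≡⟨ cong (_* a) (Product.Σ-reindex z (a *_) (*-cancelˡ a≢0)) ⟩
    P * a                                 ∎)
    where
    zᵈ cᵈ dᵈ : ∀ {x} → Dec (x ≡ 0#) → Carrier
    zᵈ {x} x? = if does x? then 1# else x
    cᵈ x? = if does x? then 1# else a
    dᵈ x? = if does x? then a else 1#
    z c d : Carrier → Carrier
    z x = zᵈ (x ≟ 0#)
    c x = cᵈ (x ≟ 0#)
    d x = dᵈ (x ≟ 0#)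
    P = Product.Σ z
    z≢0 : ∀ {x} (x? : Dec (x ≡ 0#)) → zᵈ x? ≢ 0#
    z≢0 (yes _)  = 0≢1 ∘ sym
    z≢0 (no x≢0) = x≢0
    P≢0 : P ≢ 0#
    P≢0 = product≢0 λ i → z≢0 (element i ≟ 0#)
    c*d≡a : ∀ {x} (x? : Dec (x ≡ 0#)) → cᵈ x? * dᵈ x? ≡ a
    c*d≡a (yes _) = *-identityˡ a
    c*d≡a (no _)  = *-identityʳ a
    d≡1 : ∀ {x} (x? : Dec (x ≡ 0#)) → x ≢ 0# → dᵈ x? ≡ 1#
    d≡1 (yes x≡0) x≢0 = contradiction x≡0 x≢0
    d≡1 (no _)    x≢0 = refl
    d0≡a : (0? : Dec (0# ≡ 0#)) → dᵈ 0? ≡ a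
    d0≡a (yes _)  = refl
    d0≡a (no 0≢0) = contradiction refl 0≢0
    z[ax]≡cz : ∀ {x} (ax? : Dec (a * x ≡ 0#)) (x? : Dec (x ≡ 0#)) → zᵈ ax? ≡ cᵈ x? * zᵈ x?
    z[ax]≡cz     (yes _)    (yes _)   = sym (*-identityˡ 1#)
    z[ax]≡cz     (no ax≢0)  (yes x≡0) = contradiction (trans (cong (a *_) x≡0) (zeroʳ a)) ax≢0
    z[ax]≡cz     (yes ax≡0) (no x≢0)  = contradiction ax≡0 (x*y≢0 a≢0 x≢0)
    z[ax]≡cz     (no _)     (no _)    = refl

  -- cs lists the coefficients from the constant term up, without the leading 1#.
  monic : ∀ {d} → Vec Carrier d → Carrier → Carrier
  monic []       x = 1#
  monic (c ∷ cs) x = c + x * monic cs x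

  -- Synthetic division by `X - r`: the coefficients of the quotient are the intermediate values of
  -- Horner's scheme at `r`.
  quotient : ∀ {d} → Vec Carrier (suc d) → Carrier → Vec Carrier d
  quotient (c ∷ [])         r = []
  quotient (c ∷ cs@(_ ∷ _)) r = monic cs r ∷ quotient cs r

  monic-quotient : ∀ {d} (cs : Vec Carrier (suc d)) r x →
                   monic cs x ≡ monic cs r + (x - r) * monic (quotient cs r) x
  monic-quotient (c ∷ []) r x =
    solve 3 (λ c r x → c :+ x :* con (ℤ.+ 1) := (c :+ r :* con (ℤ.+ 1)) :+ (x :- r) :* con (ℤ.+ 1)) refl c r x
  monic-quotient (c ∷ cs@(_ ∷ _)) r x = begin
    c + x * monic cs x
      ≡⟨ cong (λ y → c + x * y) (monic-quotient cs r x) ⟩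
    c + x * (monic cs r + (x - r) * m)
      ≡⟨ solve 5 (λ c r x e m → c :+ x :* (e :+ (x :- r) :* m) := (c :+ r :* e) :+ (x :- r) :* (e :+ x :* m))
           refl c r x (monic cs r) m ⟩
    (c + r * monic cs r) + (x - r) * (monic cs r + x * m)
      ∎
    where m = monic (quotient cs r) x

  -- Splitting off one root lowers the degree by one, and the other roots pass to the quotient
  -- because their differences from that root can be cancelled.
  roots≤degree : ∀ {d} (cs : Vec Carrier d) (roots : Fin (suc d) → Carrier) →
                 Injective _≡_ _≡_ roots → ¬ (∀ i → monic cs (roots i) ≡ 0#)
  roots≤degree []       roots roots-injective vanish = 0≢1 (sym (vanish zero))
  roots≤degree cs@(_ ∷ _) roots roots-injective vanish =
    roots≤degree (quotient cs r) (roots ∘ suc) (sucᶠ-injective ∘ roots-injective) λ i →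
      *-cancelˡ (λ eq → contradiction (roots-injective (x-y≡0⇒x≡y eq)) λ ()) (begin
        (roots (suc i) - r) * monic (quotient cs r) (roots (suc i))
          ≡⟨ +-identityˡ _ ⟨
        0# + (roots (suc i) - r) * monic (quotient cs r) (roots (suc i))
          ≡⟨ cong (_+ (roots (suc i) - r) * monic (quotient cs r) (roots (suc i))) (vanish zero) ⟨
        monic cs r + (roots (suc i) - r) * monic (quotient cs r) (roots (suc i))
          ≡⟨ monic-quotient cs r (roots (suc i)) ⟨
        monic cs (roots (suc i))
          ≡⟨ vanish (suc i) ⟩
        0#
          ≡⟨ zeroʳ _ ⟨
        (roots (suc i) - r) * 0#
          ∎)
    where r = roots zero

  -- A property of functions: root counting needs only the values of a polynomial.
  IsMonic : ℕ → (Carrier → Carrier) → Set f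
  IsMonic d g = ∃ λ (cs : Vec Carrier d) → ∀ x → g x ≡ monic cs x

  monic-replicate-0 : ∀ d x → x ^ d ≡ monic (replicate d 0#) x
  monic-replicate-0 zero    x = refl
  monic-replicate-0 (suc d) x =
    trans (cong (x *_) (monic-replicate-0 d x)) (sym (+-identityˡ _))

  monic-+-power : ∀ {d e} (cs : Vec Carrier d) → e ℕ.< d → IsMonic d (λ x → x ^ e + monic cs x)
  monic-+-power {e = zero}  (c ∷ cs) _ = 1# + c ∷ cs , λ x → sym (+-assoc 1# c _)
  monic-+-power {e = suc e} (c ∷ cs) (s≤s e<d) with ds , eq ← monic-+-power cs e<d =
    c ∷ ds , λ x → begin
      x * x ^ e + (c + x * monic cs x)
        ≡⟨ solve 4 (λ x y c m → x :* y :+ (c :+ x :* m) := c :+ x :* (y :+ m)) refl x (x ^ e) c (monic cs x) ⟩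
      c + x * (x ^ e + monic cs x)
        ≡⟨ cong (λ y → c + x * y) (eq x) ⟩
      c + x * monic ds x
        ∎

  -- Strictly increasing exponents leave a single leading term. The intended case is `e i = p ^ i`,
  -- the trace polynomial.
  sum-of-powers-monic : ∀ m (e : ℕ → ℕ) → (∀ {i j} → i ℕ.< j → e i ℕ.< e j) →
                        IsMonic (e m) (λ x → sum {suc m} λ i → x ^ e (toℕ i))
  sum-of-powers-monic zero    e e-mono =
    replicate (e 0) 0# , λ x → trans (+-identityʳ _) (monic-replicate-0 (e 0) x)
  sum-of-powers-monic (suc m) e e-mono
    with cs , eq ← sum-of-powers-monic m (e ∘ suc) (e-mono ∘ s≤s)
    with ds , eq′ ← monic-+-power cs (e-mono {0} {suc m} z<s) =
    ds , λ x → trans (cong (x ^ e 0 +_) (eq x)) (eq′ x)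

  element-injective : Injective _≡_ _≡_ element
  element-injective eq = trans (sym (Inverse.strictlyInverseˡ enumeration _))
    (trans (cong (Inverse.to enumeration) eq) (Inverse.strictlyInverseˡ enumeration _))

  monic-nonvanishing : ∀ {d g} → IsMonic d g → d ℕ.< q → ∃ λ x → g x ≢ 0#
  monic-nonvanishing {d} {g} (cs , g≡cs) d<q
    with any? (λ (i : Fin (suc d)) → ¬? (g (element (inject≤ i d<q)) ≟ 0#))
  ... | yes (i , g≢0) = _ , g≢0
  ... | no all-zero = contradiction
    (λ i → trans (sym (g≡cs _)) (decidable-stable (_ ≟ 0#) λ g≢0 → all-zero (i , g≢0)))
    (roots≤degree cs _ (λ eq → inject≤-injective d<q d<q _ _ (element-injective eq)))

-- Characteristic p: Frobenius, the prime subfield, the trace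

module Characteristic {f q} (F : FiniteField f q) {p n : ℕ} (p-prime : Prime p) (q≡p^n : q ≡ p ℕ.^ n) where
  open FieldTheory F
  open ≡ using (refl; sym; trans; cong; cong₂; subst)
  open ≡.≡-Reasoning

  instance
    p-nonZero : NonZero p
    p-nonZero = prime⇒nonZero p-prime

  1<p : 1 ℕ.< p
  1<p = ℕ.nonTrivial⇒n>1 p {{prime⇒nonTrivial p-prime}}

  -- The `n`-th power of `p · 1#` is `q · 1#`, which vanishes, and a field has no nonzero nilpotent
  -- element.
  p·1≡0 : p · 1# ≡ 0#
  p·1≡0 = x^n≡0⇒x≡0 n (trans (sym (^·1 n)) (trans (cong (_· 1#) (sym q≡p^n)) size·1≡0))
    where
    ^·1 : ∀ n → (p ℕ.^ n) · 1# ≡ (p · 1#) ^ n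
    ^·1 zero    = +-identityʳ 1#
    ^·1 (suc n) = trans (×1-homo-* p (p ℕ.^ n)) (cong (p · 1# *_) (^·1 n))

  p·x≡0 : ∀ x → p · x ≡ 0#
  p·x≡0 x = begin
    p · x        ≡⟨ cong (p ·_) (*-identityˡ x) ⟨
    p · (1# * x) ≡⟨ ×-assoc-* p 1# x ⟨
    p · 1# * x   ≡⟨ cong (_* x) p·1≡0 ⟩
    0# * x       ≡⟨ zeroˡ x ⟩
    0#           ∎

  multiple·1≡0 : ∀ m → (m ℕ.* p) · 1# ≡ 0#
  multiple·1≡0 m = trans (×1-homo-* m p) (trans (cong (m · 1# *_) p·1≡0) (zeroʳ _))

  ∣⇒·≡0 : ∀ {m} → p ∣ m → ∀ x → m · x ≡ 0#
  ∣⇒·≡0 (divides m refl) x = begin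
    (m ℕ.* p) · x ≡⟨ cong (_· x) (ℕ.*-comm m p) ⟩
    (p ℕ.* m) · x ≡⟨ ×-assocˡ x p m ⟨
    p · (m · x)   ≡⟨ p·x≡0 (m · x) ⟩
    0#            ∎

  -- Only the two ends of the binomial expansion survive, the inner coefficients being multiples of
  -- `p`.
  frobenius : ∀ x y → (x + y) ^ p ≡ x ^ p + y ^ p
  frobenius x y = trans (Binomial.theorem commutativeSemiring p x y)
                        (ends p refl)
    where
    open Binomial commutativeSemiring using (binomialTerm)
    open SumProperties using (sum-cong-≗)
    -- The exponent is generalised so that matching exposes it as a successor; this splits both end
    -- terms off the sum.
    ends : ∀ r → r ≡ p → sum (binomialTerm x y r) ≡ x ^ r + y ^ r
    ends zero    0≡p = contradiction (subst (1 ℕ.<_) (sym 0≡p) 1<p) λ ()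
    ends (suc r) refl = begin
      binomialTerm x y (suc r) zero + sum (binomialTerm x y (suc r) ∘ suc)
        ≡⟨ cong (binomialTerm x y (suc r) zero +_) (Sum.sum-single (fromℕ r) middle) ⟩
      binomialTerm x y (suc r) zero + binomialTerm x y (suc r) (suc (fromℕ r))
        ≡⟨ cong₂ _+_ first last ⟩
      y ^ suc r + x ^ suc r
        ≡⟨ +-comm _ _ ⟩
      x ^ suc r + y ^ suc r
        ∎
      where
      middle : ∀ j → j ≢ fromℕ r → binomialTerm x y (suc r) (suc j) ≡ 0#
      middle j j≢r = ∣⇒·≡0 (p∣pCk p-prime z<s (s≤s (ℕ.≤∧≢⇒< (ℕ.s≤s⁻¹ (toℕ<n j))
        λ eq → j≢r (toℕ-injective (trans eq (sym (toℕ-fromℕ r))))))) _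
      first : binomialTerm x y (suc r) zero ≡ y ^ suc r
      first = trans (×-homo-1 _) (*-identityˡ _)
      last : binomialTerm x y (suc r) (suc (fromℕ r)) ≡ x ^ suc r
      last = begin
        (suc r C suc (toℕ (fromℕ r))) · (x ^ suc (toℕ (fromℕ r)) * y ^ (r ∸ toℕ (fromℕ r)))
          ≡⟨ cong (λ i → (suc r C suc i) · (x ^ suc i * y ^ (r ∸ i))) (toℕ-fromℕ r) ⟩
        (suc r C suc r) · (x ^ suc r * y ^ (r ∸ r))
          ≡⟨ cong₂ (λ i j → i · (x ^ suc r * y ^ j)) (nCn≡1 (suc r)) (ℕ.n∸n≡0 r) ⟩
        1 · (x ^ suc r * 1#)
          ≡⟨ ×-homo-1 _ ⟩
        x ^ suc r * 1#
          ≡⟨ *-identityʳ _ ⟩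
        x ^ suc r
          ∎

  -- As `p` and `m` are coprime, a Bézout relation would turn `p · 1# = 0#` and `m · 1# = 0#` into
  -- `1# = 0#`.
  ·1-nonzero : ∀ {m} → 0 ℕ.< m → m ℕ.< p → m · 1# ≢ 0#
  ·1-nonzero {m} 0<m m<p m·1≡0 =
    absurd (coprime-Bézout (prime⇒coprime p-prime {{ℕ.>-nonZero 0<m}} m<p))
    where
    multiple≡0 : ∀ y → (y ℕ.* m) · 1# ≡ 0#
    multiple≡0 y = trans (×1-homo-* y m) (trans (cong (y · 1# *_) m·1≡0) (zeroʳ _))
    1≡0 : ∀ {a b} → 1 ℕ.+ a ≡ b → a · 1# ≡ 0# → b · 1# ≡ 0# → 1# ≡ 0#
    1≡0 {a} {b} 1+a≡b a≡0 b≡0 = begin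
      1#           ≡⟨ +-identityʳ 1# ⟨
      1# + 0#      ≡⟨ cong (1# +_) a≡0 ⟨
      (1 ℕ.+ a) · 1# ≡⟨ cong (_· 1#) 1+a≡b ⟩
      b · 1#       ≡⟨ b≡0 ⟩
      0#           ∎
    absurd : ¬ (Bézout.Identity 1 p m)
    absurd (Bézout.+- x y eq) = 0≢1 (sym (1≡0 eq (multiple≡0 y) (multiple·1≡0 x)))
    absurd (Bézout.-+ x y eq) = 0≢1 (sym (1≡0 eq (multiple·1≡0 x) (multiple≡0 y)))

  ·1-≤-injective : ∀ {a b} → a ℕ.≤ b → b ℕ.< p → a · 1# ≡ b · 1# → a ≡ b
  ·1-≤-injective {a} {b} a≤b b<p eq with ℕ.m≤n⇒m<n∨m≡n a≤b
  ... | inj₂ a≡b = a≡b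
  ... | inj₁ a<b = contradiction
    (+-cancelˡ (a · 1#) _ _ (begin
      a · 1# + (b ∸ a) · 1# ≡⟨ ×-homo-+ 1# a (b ∸ a) ⟨
      (a ℕ.+ (b ∸ a)) · 1#  ≡⟨ cong (_· 1#) (ℕ.m+[n∸m]≡n a≤b) ⟩
      b · 1#                ≡⟨ eq ⟨
      a · 1#                ≡⟨ +-identityʳ _ ⟨
      a · 1# + 0#           ∎))
    (·1-nonzero (ℕ.m<n⇒0<n∸m a<b) (ℕ.≤-<-trans (ℕ.m∸n≤m b a) b<p))

  ·1-injective : ∀ {a b} → a ℕ.< p → b ℕ.< p → a · 1# ≡ b · 1# → a ≡ b
  ·1-injective {a} {b} a<p b<p eq with ℕ.≤-total a b
  ... | inj₁ a≤b = ·1-≤-injective a≤b b<p eq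
  ... | inj₂ b≤a = sym (·1-≤-injective b≤a a<p (sym eq))

  %·1 : ∀ a → (a % p) · 1# ≡ a · 1#
  %·1 a = sym (begin
    a · 1#                                  ≡⟨ cong (_· 1#) (m≡m%n+[m/n]*n a p) ⟩
    (a % p ℕ.+ a / p ℕ.* p) · 1#            ≡⟨ ×-homo-+ 1# (a % p) (a / p ℕ.* p) ⟩
    (a % p) · 1# + (a / p ℕ.* p) · 1#       ≡⟨ cong ((a % p) · 1# +_) (multiple·1≡0 (a / p)) ⟩
    (a % p) · 1# + 0#                       ≡⟨ +-identityʳ _ ⟩
    (a % p) · 1#                            ∎)

  ·1≡·1⇒%≡% : ∀ {a b} → a · 1# ≡ b · 1# → a % p ≡ b % p
  ·1≡·1⇒%≡% {a} {b} eq = ·1-injective (m%n<n a p) (m%n<n b p)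
    (trans (%·1 a) (trans eq (sym (%·1 b))))

  -- Fermat's little theorem, by induction on `a` with Frobenius applied to `1# + a · 1#`.
  [·1]^p : ∀ a → (a · 1#) ^ p ≡ a · 1#
  [·1]^p zero    = 0^n≡0 p
    where
    0^n≡0 : ∀ n .{{_ : NonZero n}} → 0# ^ n ≡ 0#
    0^n≡0 (suc n) = zeroˡ _
  [·1]^p (suc a) = trans (frobenius 1# (a · 1#)) (cong₂ _+_ (1^n≡1 p) ([·1]^p a))
    where
    1^n≡1 : ∀ n → 1# ^ n ≡ 1#
    1^n≡1 zero    = refl
    1^n≡1 (suc n) = trans (*-identityˡ _) (1^n≡1 n)

  x^p-x-monic : IsMonic p (λ x → x ^ p - x)
  x^p-x-monic = degree p 1<p
    where
    degree : ∀ r → 1 ℕ.< r → IsMonic r (λ x → x ^ r - x)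
    degree (suc (suc r)) _ = 0# ∷ - 1# ∷ replicate r 0# , λ x → begin
      x * (x * x ^ r) - x
        ≡⟨ cong (λ y → x * (x * y) - x) (monic-replicate-0 r x) ⟩
      x * (x * m x) - x
        ≡⟨ solve 2 (λ x m → x :* (x :* m) :- x := con (ℤ.+ 0) :+ x :* (:- con (ℤ.+ 1) :+ x :* m)) refl x (m x) ⟩
      0# + x * (- 1# + x * m x)
        ∎
      where m = monic (replicate r 0#)
    degree (suc zero) (s≤s ())

  -- X ^ p - X already has the p roots t · 1.
  prime-subfield : ∀ {y} → y ^ p ≡ y → ∃ λ (t : Fin p) → toℕ t · 1# ≡ y
  prime-subfield {y} y^p≡y with any? (λ (t : Fin p) → (toℕ t · 1#) ≟ y)
  ... | yes found = found
  ... | no ¬found = contradiction vanish (roots≤degree (proj₁ x^p-x-monic) roots roots-injective)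
    where
    roots : Fin (suc p) → Carrier
    roots zero    = y
    roots (suc t) = toℕ t · 1#
    roots-injective : Injective _≡_ _≡_ roots
    roots-injective {zero}  {zero}  eq = refl
    roots-injective {zero}  {suc t} eq = contradiction (t , sym eq) ¬found
    roots-injective {suc t} {zero}  eq = contradiction (t , eq) ¬found
    roots-injective {suc s} {suc t} eq = cong suc (toℕ-injective (·1-injective (toℕ<n s) (toℕ<n t) eq))
    fixed : ∀ i → roots i ^ p ≡ roots i
    fixed zero    = y^p≡y
    fixed (suc t) = [·1]^p (toℕ t)
    vanish : ∀ i → monic (proj₁ x^p-x-monic) (roots i) ≡ 0#
    vanish i = trans (sym (proj₂ x^p-x-monic (roots i)))
      (trans (cong (_- roots i) (fixed i)) (-‿inverseʳ (roots i)))

  frobenius-iterate : ∀ i x y → (x + y) ^ (p ℕ.^ i) ≡ x ^ (p ℕ.^ i) + y ^ (p ℕ.^ i)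
  frobenius-iterate zero    x y = trans (*-identityʳ _) (cong₂ _+_ (sym (*-identityʳ x)) (sym (*-identityʳ y)))
  frobenius-iterate (suc i) x y = begin
    (x + y) ^ (p ℕ.* p ℕ.^ i)                         ≡⟨ ^-assocʳ (x + y) p (p ℕ.^ i) ⟨
    ((x + y) ^ p) ^ (p ℕ.^ i)                         ≡⟨ cong (_^ (p ℕ.^ i)) (frobenius x y) ⟩
    (x ^ p + y ^ p) ^ (p ℕ.^ i)                       ≡⟨ frobenius-iterate i (x ^ p) (y ^ p) ⟩
    (x ^ p) ^ (p ℕ.^ i) + (y ^ p) ^ (p ℕ.^ i)         ≡⟨ cong₂ _+_ (^-assocʳ x p (p ℕ.^ i)) (^-assocʳ y p (p ℕ.^ i)) ⟩
    x ^ (p ℕ.* p ℕ.^ i) + y ^ (p ℕ.* p ℕ.^ i)         ∎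

  -- The same sum as `Tr` of the canonical character, stated without reference to the scalars or the
  -- root of unity.
  trace : Carrier → Carrier
  trace x = sum {n} λ i → x ^ (p ℕ.^ toℕ i)

  trace-+ : ∀ x y → trace (x + y) ≡ trace x + trace y
  trace-+ x y = trans (SumProperties.sum-cong-≗ {n} (λ i → frobenius-iterate (toℕ i) x y))
    (SumProperties.∑-distrib-+ {n} (λ i → x ^ (p ℕ.^ toℕ i)) (λ i → y ^ (p ℕ.^ toℕ i)))

  sum^p : ∀ {m} (t : Fin m → Carrier) → sum t ^ p ≡ sum (λ i → t i ^ p)
  sum^p {zero}  t = [·1]^p 0
  sum^p {suc m} t = trans (frobenius _ _) (cong (t zero ^ p +_) (sum^p (t ∘ suc)))

  telescope : ∀ m (t : ℕ → Carrier) → t 0 + sum {m} (λ i → t (suc (toℕ i))) ≡ sum {m} (t ∘ toℕ) + t m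
  telescope zero    t = trans (+-identityʳ _) (sym (+-identityˡ _))
  telescope (suc m) t = trans (cong (t 0 +_) (telescope m (t ∘ suc))) (sym (+-assoc _ _ _))

  -- Frobenius moves each conjugate to the next one, and `x ^ (p ^ n) = x ^ q = x` closes the cycle.
  -- Adding `x` on both sides expresses this shift without subtraction.
  trace^p : ∀ x → trace x ^ p ≡ trace x
  trace^p x = +-cancelˡ x _ _ (begin
    x + trace x ^ p
      ≡⟨ cong (x +_) (sum^p {n} (λ i → x ^ (p ℕ.^ toℕ i))) ⟩
    x + sum {n} (λ i → (x ^ (p ℕ.^ toℕ i)) ^ p)
      ≡⟨ cong₂ _+_ (sym (*-identityʳ x)) (SumProperties.sum-cong-≗ {n} λ i →
           trans (^-assocʳ x (p ℕ.^ toℕ i) p) (cong (x ^_) (ℕ.*-comm _ p))) ⟩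
    x ^ (p ℕ.^ 0) + sum {n} (λ i → x ^ (p ℕ.^ suc (toℕ i)))
      ≡⟨ telescope n (λ i → x ^ (p ℕ.^ i)) ⟩
    trace x + x ^ (p ℕ.^ n)
      ≡⟨ cong (trace x +_) (trans (cong (x ^_) (sym q≡p^n)) (x^q≡x x)) ⟩
    trace x + x
      ≡⟨ +-comm _ _ ⟩
    x + trace x
      ∎)

  -- The trace is given by a monic polynomial of degree `p ^ (n - 1)`, too small for all `q`
  -- elements to be roots.
  trace-nonvanishing : 1 ℕ.≤ n → ∃ λ x → trace x ≢ 0#
  trace-nonvanishing 1≤n = go n q≡p^n 1≤n
    where
    p^-mono : ∀ {i j} → i ℕ.< j → p ℕ.^ i ℕ.< p ℕ.^ j
    p^-mono = ℕ.^-monoʳ-< p 1<p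
    go : ∀ r → q ≡ p ℕ.^ r → 1 ℕ.≤ r → ∃ λ x → sum {r} (λ i → x ^ (p ℕ.^ toℕ i)) ≢ 0#
    go (suc r) q≡ _ = monic-nonvanishing (sum-of-powers-monic r (p ℕ.^_) p^-mono)
      (subst (p ℕ.^ r ℕ.<_) (sym q≡) (p^-mono (ℕ.n<1+n r)))

find-satisfies : ∀ {a p} {A : Set a} {P : Pred A p} (P? : Decidable P) {xs : List A} →
                 Any P xs → ∃ λ x → find P? xs ≡ just x × P x
find-satisfies P? {x List.∷ xs} any with P? x
... | yes px = x , ≡.refl , px
find-satisfies P? (here px)   | no ¬px = contradiction px ¬px
find-satisfies P? (there any) | no _   = find-satisfies P? any

-- Squares when q is 3 modulo 4

module ThreeModFour {f q} (F : FiniteField f q) (q%4≡3 : q % 4 ≡ 3) where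
  open FieldTheory F
  open ≡ using (refl; sym; trans; cong)
  open ≡.≡-Reasoning

  r : ℕ
  r = q / 4

  q≡3+r*4 : q ≡ 3 ℕ.+ r ℕ.* 4
  q≡3+r*4 = trans (m≡m%n+[m/n]*n q 4) (cong (ℕ._+ r ℕ.* 4) q%4≡3)

  -- As `q` is odd, `q · x` is `x` plus a multiple of `x + x`, while `q · x` vanishes.
  x+x≡0⇒x≡0 : ∀ {x} → x + x ≡ 0# → x ≡ 0#
  x+x≡0⇒x≡0 {x} x+x≡0 = begin
    x                          ≡⟨ +-identityʳ x ⟨
    x + 0#                     ≡⟨ cong (x +_) (even m) ⟨
    (1 ℕ.+ m ℕ.* 2) · x        ≡⟨ cong (_· x) q≡1+m*2 ⟨
    q · x                      ≡⟨ cong (q ·_) (*-identityˡ x) ⟨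
    q · (1# * x)               ≡⟨ ×-assoc-* q 1# x ⟨
    q · 1# * x                 ≡⟨ cong (_* x) size·1≡0 ⟩
    0# * x                     ≡⟨ zeroˡ x ⟩
    0#                         ∎
    where
    m = 1 ℕ.+ r ℕ.* 2
    q≡1+m*2 : q ≡ 1 ℕ.+ m ℕ.* 2
    q≡1+m*2 = trans q≡3+r*4 (cong (3 ℕ.+_) (sym (ℕ.*-assoc r 2 2)))
    2·x≡0 : 2 · x ≡ 0#
    2·x≡0 = trans (cong (x +_) (+-identityʳ x)) x+x≡0
    n·0≡0 : ∀ n → n · 0# ≡ 0#
    n·0≡0 zero    = refl
    n·0≡0 (suc n) = trans (+-identityˡ _) (n·0≡0 n)
    even : ∀ m → (m ℕ.* 2) · x ≡ 0#
    even m = trans (sym (×-assocˡ x m 2)) (trans (cong (m ·_) 2·x≡0) (n·0≡0 m))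

  x≡-x⇒x≡0 : ∀ {x} → x ≡ - x → x ≡ 0#
  x≡-x⇒x≡0 {x} x≡-x = x+x≡0⇒x≡0 (trans (cong (x +_) x≡-x) (-‿inverseʳ x))

  -x*-x≡x*x : ∀ x → - x * - x ≡ x * x
  -x*-x≡x*x = solve 1 (λ x → :- x :* :- x := x :* x) refl

  -- This is `x ^ (2m + 1)`, written through `x * x` so that its oddness in `x` is visible.
  oddPower : ℕ → Carrier → Carrier
  oddPower m x = x * (x * x) ^ m

  oddPower-neg : ∀ m x → oddPower m (- x) ≡ - oddPower m x
  oddPower-neg m x = begin
    - x * (- x * - x) ^ m ≡⟨ cong (λ y → - x * y ^ m) (-x*-x≡x*x x) ⟩
    - x * (x * x) ^ m     ≡⟨ -‿distribˡ-* x _ ⟨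
    - oddPower m x        ∎

  -- This regroups `x ^ q = x`: the second factor is the power of `x * x` with exponent
  -- `(q - 1) / 2 = 2r + 1`, an odd number.
  x^[3+r*4]≡ : ∀ x → x * oddPower r (x * x) ≡ x
  x^[3+r*4]≡ x = begin
    x * (x * x * (x * x * (x * x)) ^ r)
      ≡⟨ cong (λ y → x * (x * x * y ^ r))
           (solve 1 (λ x → x :* x :* (x :* x) := x :* (x :* (x :* (x :* con (ℤ.+ 1))))) refl x) ⟩
    x * (x * x * (x ^ 4) ^ r)
      ≡⟨ cong (λ y → x * (x * x * y)) (trans (^-assocʳ x 4 r) (cong (x ^_) (ℕ.*-comm 4 r))) ⟩
    x * (x * x * x ^ (r ℕ.* 4))
      ≡⟨ cong (x *_) (*-assoc x x _) ⟩
    x ^ (3 ℕ.+ r ℕ.* 4)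
      ≡⟨ cong (x ^_) q≡3+r*4 ⟨
    x ^ q
      ≡⟨ x^q≡x x ⟩
    x
      ∎

  x*x≡0⇒x≡0 : ∀ {x} → x * x ≡ 0# → x ≡ 0#
  x*x≡0⇒x≡0 = [ id , id ]′ ∘ x*y≡0⇒x≡0∨y≡0

  -- Raising x² = - y² to the odd power (q - 1) / 2 gives x = - x unless y = 0.
  x*x≡-y*y⇒y≡0 : ∀ {x y} → x * x ≡ - (y * y) → y ≡ 0#
  x*x≡-y*y⇒y≡0 {x} {y} eq = [ x≡0⇒y≡0 , id ]′ (x*y≡0⇒x≡0∨y≡0 (x≡-x⇒x≡0 (begin
    x * y                                ≡⟨ cong (_* y) (x^[3+r*4]≡ x) ⟨
    x * oddPower r (x * x) * y           ≡⟨ cong (λ u → x * oddPower r u * y) eq ⟩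
    x * oddPower r (- (y * y)) * y       ≡⟨ cong (λ u → x * u * y) (oddPower-neg r (y * y)) ⟩
    x * - oddPower r (y * y) * y         ≡⟨ solve 3 (λ x o y → x :* :- o :* y := :- (x :* (y :* o))) refl x _ y ⟩
    - (x * (y * oddPower r (y * y)))     ≡⟨ cong (λ u → - (x * u)) (x^[3+r*4]≡ y) ⟩
    - (x * y)                            ∎)))
    where
    x≡0⇒y≡0 : x ≡ 0# → y ≡ 0#
    x≡0⇒y≡0 x≡0 = x*x≡0⇒x≡0 (-‿injective (begin
      - (y * y)   ≡⟨ eq ⟨
      x * x       ≡⟨ cong (λ u → u * u) x≡0 ⟩
      0# * 0#     ≡⟨ zeroˡ 0# ⟩
      0#          ≡⟨ -0#≈0# ⟨
      - 0#        ∎))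

  -- x ↦ η(x) x² for the quadratic character η.
  signedSquare : Carrier → Carrier
  signedSquare = oddPower (suc r)

  -- The exponent of `signedSquare` is `2r + 3 = (q - 1) / 2 + 2`. Doubling it gives `q + 3`, and
  -- `x ^ q = x` reduces this to 4.
  signedSquare² : ∀ x → signedSquare x * signedSquare x ≡ (x * x) * (x * x)
  signedSquare² x = begin
    oddPower (suc r) x * oddPower (suc r) x
      ≡⟨ solve 2 (λ x s → x :* (x :* x :* s) :* (x :* (x :* x :* s)) :=
                          x :* (x :* (x :* x :* (s :* s))) :* (x :* x)) refl x s ⟩
    x * (x * (x * x * (s * s))) * (x * x)
      ≡⟨ cong (λ u → x * (x * (x * x * u)) * (x * x)) (^-distrib-* (x * x) (x * x) r) ⟨
    x * (x * (x * x * (x * x * (x * x)) ^ r)) * (x * x)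
      ≡⟨ cong (λ u → x * u * (x * x)) (x^[3+r*4]≡ x) ⟩
    (x * x) * (x * x)
      ∎
    where s = (x * x) ^ r

  x²≡y²⇒x≡±y : ∀ {x y} → x * x ≡ y * y → x ≡ y ⊎ x ≡ - y
  x²≡y²⇒x≡±y {x} {y} eq with x*y≡0⇒x≡0∨y≡0 (begin
    (x - y) * (x + y) ≡⟨ solve 2 (λ x y → (x :- y) :* (x :+ y) := x :* x :- y :* y) refl x y ⟩
    x * x - y * y     ≡⟨ cong (_- y * y) eq ⟩
    y * y - y * y     ≡⟨ -‿inverseʳ _ ⟩
    0#                ∎)
  ... | inj₁ x-y≡0 = inj₁ (x-y≡0⇒x≡y x-y≡0)
  ... | inj₂ x+y≡0 = inj₂ (x-y≡0⇒x≡y (trans (cong (x +_) (-‿involutive y)) x+y≡0))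

  signedSquare≡±square : ∀ x → signedSquare x ≡ x * x ⊎ signedSquare x ≡ - (x * x)
  signedSquare≡±square x = x²≡y²⇒x≡±y (signedSquare² x)

  signedSquare≡0⇒x≡0 : ∀ {x} → signedSquare x ≡ 0# → x ≡ 0#
  signedSquare≡0⇒x≡0 {x} φx≡0 = x*x≡0⇒x≡0 (x*x≡0⇒x≡0
    (trans (sym (signedSquare² x)) (trans (cong (_* signedSquare x) φx≡0) (zeroˡ _))))

  -- If x² = ± y² then either both vanish or x = ± y; since φ is odd, φ x = φ y
  -- excludes x = - y ≠ 0.
  signedSquare-injective : Injective _≡_ _≡_ signedSquare
  signedSquare-injective {x} {y} φx≡φy = [ x²≡y² , x²≡-y² ]′ (x²≡y²⇒x≡±y (begin
    x * x * (x * x)                   ≡⟨ signedSquare² x ⟨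
    signedSquare x * signedSquare x   ≡⟨ cong (λ u → u * u) φx≡φy ⟩
    signedSquare y * signedSquare y   ≡⟨ signedSquare² y ⟩
    y * y * (y * y)                   ∎))
    where
    x≡-y⇒x≡y : x ≡ - y → x ≡ y
    x≡-y⇒x≡y x≡-y = trans x≡-y (trans (cong -_ y≡0) (trans -0#≈0# (sym y≡0)))
      where
      y≡0 : y ≡ 0#
      y≡0 = signedSquare≡0⇒x≡0 (x≡-x⇒x≡0 (begin
        signedSquare y       ≡⟨ φx≡φy ⟨
        signedSquare x       ≡⟨ cong signedSquare x≡-y ⟩
        signedSquare (- y)   ≡⟨ oddPower-neg (suc r) y ⟩
        - signedSquare y     ∎))
    x²≡y² : x * x ≡ y * y → x ≡ y
    x²≡y² = [ id , x≡-y⇒x≡y ]′ ∘ x²≡y²⇒x≡±y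
    x²≡-y² : x * x ≡ - (y * y) → x ≡ y
    x²≡-y² eq = trans (x*x≡0⇒x≡0 (trans eq (trans (cong -_ y*y≡0) -0#≈0#))) (sym y≡0)
      where
      y≡0 : y ≡ 0#
      y≡0 = x*x≡-y*y⇒y≡0 eq
      y*y≡0 : y * y ≡ 0#
      y*y≡0 = trans (cong (_* y) y≡0) (zeroˡ y)

-- The scalars and the canonical character

module ScalarField {c ℓ₁ ℓ₂} (K : HeytingField c ℓ₁ ℓ₂) where
  open HeytingFieldArithmetic K public

  commutativeRingᴷ : CommutativeRing c ℓ₁
  commutativeRingᴷ = HeytingCommutativeRing.commutativeRing heytingCommutativeRing

  open CommutativeRing commutativeRingᴷ public
    using (ring; semiring; commutativeSemiring; +-commutativeMonoid)
  open RingProperties ring public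
    using (-0#≈0#; -‿distribʳ-*; -‿involutive; +-cancelˡ)
  open Exp commutativeSemiring public using (^-homo-*; ^-assocʳ; ^-distrib-*; ^-congˡ)
  open IntegerCoefficients commutativeRingᴷ public using (solve; _:=_; _:+_; _:*_; _:-_; :-_; con)
  open SetoidReasoning setoid

  -- Apartness makes `x - 1#` invertible, which takes the place of a case distinction on `z`.
  x*z≈z⇒z≈0 : ∀ {x z} → x # 1# → x * z ≈ z → z ≈ 0#
  x*z≈z⇒z≈0 {x} {z} x#1 xz≈z with i , i*[x-1]≈1 , _ ← #⇒invertible x#1 = begin
    z                   ≈⟨ *-identityˡ z ⟨
    1# * z              ≈⟨ *-congʳ i*[x-1]≈1 ⟨
    i * (x - 1#) * z    ≈⟨ solve 3 (λ i x z → i :* (x :- con (ℤ.+ 1)) :* z := i :* (x :* z :- z)) refl i x z ⟩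
    i * (x * z - z)     ≈⟨ *-congˡ (+-congʳ xz≈z) ⟩
    i * (z - z)         ≈⟨ *-congˡ (-‿inverseʳ z) ⟩
    i * 0#              ≈⟨ zeroʳ i ⟩
    0#                  ∎

  reciprocal-inverseˡ : ∀ x (x#0 : x # 0#) → reciprocal x x#0 * x ≈ 1#
  -- Apartness from `0#` provides an inverse of `x - 0#` rather than of `x`.
  reciprocal-inverseˡ x x#0 = trans (*-congˡ (sym (trans (+-congˡ -0#≈0#) (+-identityʳ x))))
                                    (proj₁ (proj₂ (#⇒invertible x#0)))

  1^n≈1 : ∀ n → 1# ^ n ≈ 1#
  1^n≈1 zero    = refl
  1^n≈1 (suc n) = trans (*-identityˡ _) (1^n≈1 n)

module CanonicalCharacterProperties {c ℓ₁ ℓ₂} (K : HeytingField c ℓ₁ ℓ₂) (ζ : HeytingField.Carrier K)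
    {f q} (F : FiniteField f q) (p n : ℕ) (p-prime : Prime p) (1≤n : 1 ℕ.≤ n) (q≡p^n : q ≡ p ℕ.^ n)
    (ζ-primitive : IsPrimitiveRootOfUnity K p ζ) where
  open ScalarField K
  private module F = FieldTheory F
  open Characteristic F {p} {n} p-prime q≡p^n
  open CanonicalCharacter K ζ F p n
  open SetoidReasoning setoid

  ζ^% : ∀ a → ζ ^ a ≈ ζ ^ (a % p)
  ζ^% a = begin
    ζ ^ a                                 ≡⟨ ≡.cong (ζ ^_) (m≡m%n+[m/n]*n a p) ⟩
    ζ ^ (a % p ℕ.+ a / p ℕ.* p)           ≈⟨ ^-homo-* ζ (a % p) (a / p ℕ.* p) ⟩
    ζ ^ (a % p) * ζ ^ (a / p ℕ.* p)       ≡⟨ ≡.cong (λ m → ζ ^ (a % p) * ζ ^ m) (ℕ.*-comm (a / p) p) ⟩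
    ζ ^ (a % p) * ζ ^ (p ℕ.* (a / p))     ≈⟨ *-congˡ (^-assocʳ ζ p (a / p)) ⟨
    ζ ^ (a % p) * (ζ ^ p) ^ (a / p)       ≈⟨ *-congˡ (^-congˡ (a / p) (proj₁ ζ-primitive)) ⟩
    ζ ^ (a % p) * 1# ^ (a / p)            ≈⟨ *-congˡ (1^n≈1 (a / p)) ⟩
    ζ ^ (a % p) * 1#                      ≈⟨ *-identityʳ _ ⟩
    ζ ^ (a % p)                           ∎

  -- Both the powers of `ζ` and the multiples of `1#` depend only on the exponent modulo `p`; the
  -- multiples determine it. Identities between traces thus become identities between values of `χ`.
  ζ^-cong : ∀ a b → a F.· F.1# ≡ b F.· F.1# → ζ ^ a ≈ ζ ^ b
  ζ^-cong a b eq = begin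
    ζ ^ a       ≈⟨ ζ^% a ⟩
    ζ ^ (a % p) ≡⟨ ≡.cong (ζ ^_) (·1≡·1⇒%≡% {a} {b} eq) ⟩
    ζ ^ (b % p) ≈⟨ ζ^% b ⟨
    ζ ^ b       ∎

  -- A fixed point of Frobenius lies in the prime subfield, so the search over `upTo p` succeeds and
  -- never falls back on its default.
  residue·1 : ∀ {y} → y F.^ p ≡ y → residue y F.· F.1# ≡ y
  residue·1 {y} y^p≡y
    with t , t·1≡y ← prime-subfield y^p≡y
    with s , found , s·1≡y ← find-satisfies (λ t → (t F.· F.1#) F.≟ y) (lose (∈-upTo⁺ (toℕ<n t)) t·1≡y) =
    ≡.trans (≡.cong (λ s → fromMaybe 0 s F.· F.1#) found) s·1≡y

  residue-trace : ∀ x → residue (Tr x) F.· F.1# ≡ Tr x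
  residue-trace x = residue·1 (trace^p x)

  χ-+ : ∀ x y → χ (x F.+ y) ≈ χ x * χ y
  χ-+ x y = trans
    (ζ^-cong (residue (Tr (x F.+ y))) (residue (Tr x) ℕ.+ residue (Tr y)) residues)
    (^-homo-* ζ (residue (Tr x)) (residue (Tr y)))
    where
    residues : residue (Tr (x F.+ y)) F.· F.1# ≡ (residue (Tr x) ℕ.+ residue (Tr y)) F.· F.1#
    residues = ≡.trans (residue-trace (x F.+ y)) (≡.trans (trace-+ x y) (≡.sym (≡.trans
      (F.×-homo-+ F.1# (residue (Tr x)) (residue (Tr y))) (≡.cong₂ F._+_ (residue-trace x) (residue-trace y)))))

  χ-0 : χ F.0# ≈ 1#
  χ-0 = ζ^-cong (residue (Tr F.0#)) 0 (≡.trans (residue-trace F.0#) (F.+-cancelˡ (Tr F.0#) _ _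
    (≡.trans (≡.sym (trace-+ F.0# F.0#)) (≡.trans (≡.cong Tr (F.+-identityˡ F.0#)) (≡.sym (F.+-identityʳ _))))))

  -- At an element of nonzero trace the exponent is not divisible by `p`. It is reduced modulo `p`
  -- because primitivity speaks of exponents strictly between 0 and `p`.
  χ-nontrivial : ∃ λ a → χ a # 1#
  χ-nontrivial with a , Tr≢0 ← trace-nonvanishing 1≤n =
    a , #-congʳ (sym (ζ^% t)) (proj₂ ζ-primitive (t % p) (ℕ.n≢0⇒n>0 t%p≢0) (m%n<n t p))
    where
    open HeytingProperties heytingCommutativeRing using (#-congʳ)
    t = residue (Tr a)
    t%p≢0 : t % p ≢ 0
    t%p≢0 eq = Tr≢0 (≡.trans (≡.sym (residue-trace a)) (≡.trans (≡.sym (%·1 t)) (≡.cong (F._· F.1#) eq)))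

-- Additive characters and Gauss sums

record AdditiveCharacter {c ℓ₁ ℓ₂} (K : HeytingField c ℓ₁ ℓ₂) {f q} (F : FiniteField f q) :
                         Set (c ⊔ ℓ₁ ⊔ ℓ₂ ⊔ f) where
  private
    module K = HeytingField K
    module F = FiniteField F
  field
    χ            : F.Carrier → K.Carrier
    χ-+          : ∀ x y → χ (x F.+ y) K.≈ χ x K.* χ y
    χ-0          : χ F.0# K.≈ K.1#
    χ-nontrivial : ∃ λ a → χ a K.# K.1#

module CharacterSums {c ℓ₁ ℓ₂} {K : HeytingField c ℓ₁ ℓ₂} {f q} {F : FiniteField f q}
                     (ψ : AdditiveCharacter K F) where
  open AdditiveCharacter ψ
  open ScalarField K
  private module F = FieldTheory F
  open SumsOver +-commutativeMonoid F.enumeration public using (Σ; Σ-cong; Σ-reindex; Σ-single; Σ-distrib-+)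
  open SemiringSum semiring using (*-distribˡ-sum; *-distribʳ-sum; ∑-comm; sum-replicate)
  open SetoidReasoning setoid

  size : Carrier
  size = q · 1#

  Σ-*ˡ : ∀ a g → Σ (λ x → a * g x) ≈ a * Σ g
  Σ-*ˡ a g = sym (*-distribˡ-sum a (g ∘ F.element))

  Σ-*ʳ : ∀ g a → Σ (λ x → g x * a) ≈ Σ g * a
  Σ-*ʳ g a = sym (*-distribʳ-sum a (g ∘ F.element))

  Σ-swap : ∀ (g : F.Carrier → F.Carrier → Carrier) → Σ (λ x → Σ (g x)) ≈ Σ (λ y → Σ λ x → g x y)
  Σ-swap g = ∑-comm λ i j → g (F.element i) (F.element j)

  χ-cong : ∀ {x y} → x ≡ y → χ x ≈ χ y
  χ-cong eq = reflexive (≡.cong χ eq)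

  χ-inverseʳ : ∀ x → χ x * χ (F.- x) ≈ 1#
  χ-inverseʳ x = trans (sym (χ-+ x (F.- x))) (trans (χ-cong (F.-‿inverseʳ x)) χ-0)

  χ-difference : ∀ x y → χ (x F.- y) ≈ χ x * χ (F.- y)
  χ-difference x y = χ-+ x (F.- y)

  -- Translation by `a` multiplies the sum by `χ a`, which is apart from 1 for a suitable `a`.
  Σχ≈0 : Σ χ ≈ 0#
  Σχ≈0 = x*z≈z⇒z≈0 (proj₂ χ-nontrivial) (begin
    χ a * Σ χ              ≈⟨ Σ-*ˡ (χ a) χ ⟨
    Σ (λ x → χ a * χ x)    ≈⟨ Σ-cong (χ-+ a) ⟨
    Σ (λ x → χ (a F.+ x))  ≈⟨ Σ-reindex χ (a F.+_) (F.+-cancelˡ a _ _) ⟩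
    Σ χ                    ∎)
    where a = proj₁ χ-nontrivial

  Σχ-scaled≈0 : ∀ {a} → a ≢ F.0# → Σ (λ x → χ (a F.* x)) ≈ 0#
  Σχ-scaled≈0 a≢0 = trans (Σ-reindex χ (_ F.*_) (F.*-cancelˡ a≢0)) Σχ≈0

  Σ1≈size : Σ (λ _ → 1#) ≈ size
  Σ1≈size = sum-replicate q

  Σχ-zero : ∀ {a} → a ≡ F.0# → Σ (λ x → χ (a F.* x)) ≈ size
  Σχ-zero ≡.refl = trans (Σ-cong λ x → trans (χ-cong (F.zeroˡ x)) χ-0) Σ1≈size

  gauss : F.Carrier → Carrier
  gauss s = Σ λ x → χ (s F.* (x F.* x))

  completeSquare : ∀ {s w} b → (s F.+ s F.+ (s F.+ s)) F.* w ≡ F.1# →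
                   Σ (λ x → χ (s F.* (x F.* x) F.- b F.* x)) ≈ χ (F.- (w F.* (b F.* b))) * gauss s
  completeSquare {s} {w} b 4sw≡1 = begin
    Σ g                                                      ≈⟨ Σ-reindex g (F._+ d) (F.+-cancelʳ d _ _) ⟨
    Σ (λ x → g (x F.+ d))                                    ≈⟨ Σ-cong (λ x → trans (χ-cong (shift x)) (χ-+ _ _)) ⟩
    Σ (λ x → χ e * χ (s F.* (x F.* x)))                      ≈⟨ Σ-*ˡ (χ e) (λ x → χ (s F.* (x F.* x))) ⟩
    χ e * gauss s                                            ∎
    where
    g : F.Carrier → Carrier
    g x = χ (s F.* (x F.* x) F.- b F.* x)
    -- With `w = 1/4s`, the shift by `d = b/2s` removes the linear term and leaves the constant
    -- `e = - b²/4s`.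
    d = (w F.+ w) F.* b
    e = F.- (w F.* (b F.* b))
    shift : ∀ x → s F.* ((x F.+ d) F.* (x F.+ d)) F.- b F.* (x F.+ d) ≡ e F.+ s F.* (x F.* x)
    shift x = ≡.trans
      -- The solver cannot use `4s * w = 1`. The identity is therefore arranged so that the
      -- discrepancy appears as `- t + 4s * w * t`, which the hypothesis then cancels.
      (F.solve 4 (λ s w b x →
         let d = (w F.:+ w) F.:* b
             4s = s F.:+ s F.:+ (s F.:+ s)
             t = b F.:* x F.:+ w F.:* (b F.:* b) in
         s F.:* ((x F.:+ d) F.:* (x F.:+ d)) F.:- b F.:* (x F.:+ d) F.:=
         (F.:- (w F.:* (b F.:* b)) F.:+ s F.:* (x F.:* x) F.:- t) F.:+ 4s F.:* w F.:* t)
         ≡.refl s w b x)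
      (≡.trans (≡.cong (λ u → (e F.+ s F.* (x F.* x) F.- t) F.+ u F.* t) 4sw≡1)
        (F.solve 2 (λ y t → (y F.:- t) F.:+ F.con (ℤ.+ 1) F.:* t F.:= y) ≡.refl (e F.+ s F.* (x F.* x)) t))
      where t = b F.* x F.+ w F.* (b F.* b)

  module OddSize (q%4≡3 : q % 4 ≡ 3) where
    open ThreeModFour F q%4≡3

    -- Substituting `x = u + y` turns `s x² - s y²` into `s u² + 2su y`, which is linear in `y`. The
    -- sum over `y` therefore vanishes except at `u = 0`.
    gauss*gauss-neg : ∀ {s} → s ≢ F.0# → gauss s * gauss (F.- s) ≈ size
    gauss*gauss-neg {s} s≢0 = begin
      gauss s * gauss (F.- s)
        ≈⟨ Σ-*ˡ (gauss s) (λ y → χ (F.- s F.* (y F.* y))) ⟨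
      Σ (λ y → gauss s * χ (F.- s F.* (y F.* y)))
        ≈⟨ Σ-cong (λ y → shifted y) ⟩
      Σ (λ y → Σ λ u → χ (s F.* (u F.* u)) * χ (2su u F.* y))
        ≈⟨ Σ-swap (λ y u → χ (s F.* (u F.* u)) * χ (2su u F.* y)) ⟩
      Σ (λ u → Σ λ y → χ (s F.* (u F.* u)) * χ (2su u F.* y))
        ≈⟨ Σ-cong (λ u → Σ-*ˡ (χ (s F.* (u F.* u))) (λ y → χ (2su u F.* y))) ⟩
      Σ (λ u → χ (s F.* (u F.* u)) * Σ λ y → χ (2su u F.* y))
        ≈⟨ Σ-single F.0# (λ u u≢0 → trans (*-congˡ (Σχ-scaled≈0 (F.x*y≢0 2s≢0 u≢0))) (zeroʳ (χ (s F.* (u F.* u))))) ⟩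
      χ (s F.* (F.0# F.* F.0#)) * Σ (λ y → χ (2su F.0# F.* y))
        ≈⟨ *-cong (trans (χ-cong (≡.trans (≡.cong (s F.*_) (F.zeroʳ F.0#)) (F.zeroʳ s))) χ-0)
                  (Σχ-zero (F.zeroʳ (s F.+ s))) ⟩
      1# * size
        ≈⟨ *-identityˡ size ⟩
      size
        ∎
      where
      2su : F.Carrier → F.Carrier
      2su u = (s F.+ s) F.* u
      2s≢0 : s F.+ s ≢ F.0#
      2s≢0 = s≢0 ∘ x+x≡0⇒x≡0
      rearrange : ∀ y u → s F.* ((u F.+ y) F.* (u F.+ y)) F.+ F.- s F.* (y F.* y) ≡
                          s F.* (u F.* u) F.+ 2su u F.* y
      rearrange y u = F.solve 3 (λ s u y →
        s F.:* ((u F.:+ y) F.:* (u F.:+ y)) F.:+ F.:- s F.:* (y F.:* y) F.:=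
        s F.:* (u F.:* u) F.:+ (s F.:+ s) F.:* u F.:* y)
        ≡.refl s u y
      shifted : ∀ y → gauss s * χ (F.- s F.* (y F.* y)) ≈ Σ λ u → χ (s F.* (u F.* u)) * χ (2su u F.* y)
      shifted y = begin
        gauss s * χ (F.- s F.* (y F.* y))
          ≈⟨ *-congʳ (Σ-reindex (λ x → χ (s F.* (x F.* x))) (F._+ y) (F.+-cancelʳ y _ _)) ⟨
        Σ (λ u → χ (s F.* ((u F.+ y) F.* (u F.+ y)))) * χ (F.- s F.* (y F.* y))
          ≈⟨ Σ-*ʳ (λ u → χ (s F.* ((u F.+ y) F.* (u F.+ y)))) _ ⟨
        Σ (λ u → χ (s F.* ((u F.+ y) F.* (u F.+ y))) * χ (F.- s F.* (y F.* y)))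
          ≈⟨ Σ-cong (λ u → trans (sym (χ-+ _ _)) (trans (χ-cong (rearrange y u)) (χ-+ _ _))) ⟩
        Σ (λ u → χ (s F.* (u F.* u)) * χ (2su u F.* y))
          ∎

    -- {x², - x²} = {φ x, - φ x} for the permutation φ x = η(x) x².
    gauss+gauss-neg≈0 : ∀ {s} → s ≢ F.0# → gauss s + gauss (F.- s) ≈ 0#
    gauss+gauss-neg≈0 {s} s≢0 = begin
      gauss s + gauss (F.- s)
        ≈⟨ Σ-distrib-+ (λ x → χ (s F.* (x F.* x))) (λ x → χ (F.- s F.* (x F.* x))) ⟨
      Σ (λ x → χ (s F.* (x F.* x)) + χ (F.- s F.* (x F.* x)))
        ≈⟨ Σ-cong (λ x → symmetrise x (signedSquare≡±square x)) ⟩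
      Σ (λ x → χ (s F.* signedSquare x) + χ (F.- s F.* signedSquare x))
        ≈⟨ Σ-reindex (λ t → χ (s F.* t) + χ (F.- s F.* t)) signedSquare signedSquare-injective ⟩
      Σ (λ t → χ (s F.* t) + χ (F.- s F.* t))
        ≈⟨ Σ-distrib-+ (λ t → χ (s F.* t)) (λ t → χ (F.- s F.* t)) ⟩
      Σ (λ t → χ (s F.* t)) + Σ (λ t → χ (F.- s F.* t))
        ≈⟨ +-cong (Σχ-scaled≈0 s≢0) (Σχ-scaled≈0 λ -s≡0 → s≢0 (F.-‿injective (≡.trans -s≡0 (≡.sym F.-0#≈0#)))) ⟩
      0# + 0#
        ≈⟨ +-identityˡ 0# ⟩
      0#
        ∎
      where
      symmetrise : ∀ x → signedSquare x ≡ x F.* x ⊎ signedSquare x ≡ F.- (x F.* x) →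
                   χ (s F.* (x F.* x)) + χ (F.- s F.* (x F.* x)) ≈
                   χ (s F.* signedSquare x) + χ (F.- s F.* signedSquare x)
      symmetrise x (inj₁ φx) = reflexive (≡.cong (λ y → χ (s F.* y) + χ (F.- s F.* y)) (≡.sym φx))
      symmetrise x (inj₂ φx) = begin
        χ (s F.* (x F.* x)) + χ (F.- s F.* (x F.* x))
          ≈⟨ +-comm _ _ ⟩
        χ (F.- s F.* (x F.* x)) + χ (s F.* (x F.* x))
          ≈⟨ +-cong (χ-cong (move (x F.* x))) (χ-cong (double-neg (x F.* x))) ⟩
        χ (s F.* F.- (x F.* x)) + χ (F.- s F.* F.- (x F.* x))
          ≈⟨ reflexive (≡.cong (λ y → χ (s F.* y) + χ (F.- s F.* y)) (≡.sym φx)) ⟩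
        χ (s F.* signedSquare x) + χ (F.- s F.* signedSquare x)
          ∎
        where
        move : ∀ y → F.- s F.* y ≡ s F.* F.- y
        move y = F.solve 2 (λ s y → F.:- s F.:* y F.:= s F.:* F.:- y) ≡.refl s y
        double-neg : ∀ y → s F.* y ≡ F.- s F.* F.- y
        double-neg y = F.solve 2 (λ s y → s F.:* y F.:= F.:- s F.:* F.:- y) ≡.refl s y

    gauss-neg : ∀ {s} → s ≢ F.0# → gauss (F.- s) ≈ - gauss s
    gauss-neg {s} s≢0 = +-cancelˡ (gauss s) _ _ (trans (gauss+gauss-neg≈0 s≢0) (sym (-‿inverseʳ _)))

    gauss² : ∀ {s} → s ≢ F.0# → gauss s * gauss s ≈ - size
    gauss² {s} s≢0 = begin
      gauss s * gauss s           ≈⟨ -‿involutive _ ⟨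
      - - (gauss s * gauss s)     ≈⟨ -‿cong (-‿distribʳ-* _ _) ⟩
      - (gauss s * - gauss s)     ≈⟨ -‿cong (*-congˡ (gauss-neg s≢0)) ⟨
      - (gauss s * gauss (F.- s)) ≈⟨ -‿cong (gauss*gauss-neg s≢0) ⟩
      - size                      ∎

    -- The exponent is a multiple of 4 because the fourth power loses the minus sign of
    -- `gauss s * gauss s = - size`.
    gauss-power : ∀ {s} → s ≢ F.0# → ∀ j → gauss s ^ (j ℕ.* 4) ≈ size ^ (j ℕ.* 2)
    gauss-power s≢0 zero    = refl
    gauss-power {s} s≢0 (suc j) = begin
      gauss s ^ (4 ℕ.+ j ℕ.* 4)
        ≈⟨ fourth (gauss s) (gauss s ^ (j ℕ.* 4)) ⟩
      gauss s * gauss s * (gauss s * gauss s) * gauss s ^ (j ℕ.* 4)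
        ≈⟨ *-cong (*-cong (gauss² s≢0) (gauss² s≢0)) (gauss-power s≢0 j) ⟩
      - size * - size * size ^ (j ℕ.* 2)
        ≈⟨ even size (size ^ (j ℕ.* 2)) ⟩
      size ^ (2 ℕ.+ j ℕ.* 2)
        ∎
      where
      fourth : ∀ g y → g * (g * (g * (g * y))) ≈ g * g * (g * g) * y
      fourth = solve 2 (λ g y → g :* (g :* (g :* (g :* y))) := g :* g :* (g :* g) :* y) refl
      even : ∀ x y → - x * - x * y ≈ x * (x * y)
      even = solve 2 (λ x y → :- x :* :- x :* y := x :* (x :* y)) refl

-- Characters of the vector space and Fourier inversion

module VectorSpace {f q} (F : FiniteField f q) where
  open FieldTheory F
  open ≡ using (refl; sym; trans; cong; cong₂)
  open ≡.≡-Reasoning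

  infixl 6 _⊖_
  infixl 7 _∙_

  -- The length is implicit here because the proofs recurse on it.
  _⊖_ : ∀ {j} → Vec Carrier j → Vec Carrier j → Vec Carrier j
  _⊖_ {j} = Space._⊖_ F j

  _∙_ : ∀ {j} → Vec Carrier j → Vec Carrier j → Carrier
  _∙_ {j} = Space._∙_ F j

  origin : ∀ j → Vec Carrier j
  origin = Space.origin F

  ∙-comm : ∀ {j} (x y : Vec Carrier j) → x ∙ y ≡ y ∙ x
  ∙-comm []       []       = refl
  ∙-comm (a ∷ x) (b ∷ y) = cong₂ _+_ (*-comm a b) (∙-comm x y)

  ∙-⊖ : ∀ {j} (m x y : Vec Carrier j) → m ∙ (x ⊖ y) ≡ m ∙ x - m ∙ y
  ∙-⊖ []       []       []       = sym (-‿inverseʳ 0#)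
  ∙-⊖ (c ∷ m) (a ∷ x) (b ∷ y) = begin
    c * (a - b) + m ∙ (x ⊖ y)       ≡⟨ cong (c * (a - b) +_) (∙-⊖ m x y) ⟩
    c * (a - b) + (m ∙ x - m ∙ y)   ≡⟨ regroup c a b (m ∙ x) (m ∙ y) ⟩
    (c * a + m ∙ x) - (c * b + m ∙ y) ∎
    where
    regroup : ∀ c a b u v → c * (a - b) + (u - v) ≡ (c * a + u) - (c * b + v)
    regroup = solve 5 (λ c a b u v → c :* (a :- b) :+ (u :- v) := (c :* a :+ u) :- (c :* b :+ v)) refl

  origin-∙ : ∀ {j} (x : Vec Carrier j) → origin j ∙ x ≡ 0#
  origin-∙ []      = refl
  origin-∙ (a ∷ x) = trans (cong₂ _+_ (zeroˡ a) (origin-∙ x)) (+-identityˡ 0#)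

  ∙-origin : ∀ {j} (x : Vec Carrier j) → x ∙ origin j ≡ 0#
  ∙-origin x = trans (∙-comm x _) (origin-∙ x)

  ⊖-involutive : ∀ {j} (x y : Vec Carrier j) → x ⊖ (x ⊖ y) ≡ y
  ⊖-involutive []      []      = refl
  ⊖-involutive (a ∷ x) (b ∷ y) =
    cong₂ _∷_ (solve 2 (λ a b → a :- (a :- b) := b) refl a b) (⊖-involutive x y)

  x⊖x≡origin : ∀ {j} (x : Vec Carrier j) → x ⊖ x ≡ origin j
  x⊖x≡origin []      = refl
  x⊖x≡origin (a ∷ x) = cong₂ _∷_ (-‿inverseʳ a) (x⊖x≡origin x)

  x⊖y≡origin⇒x≡y : ∀ {j} (x y : Vec Carrier j) → x ⊖ y ≡ origin j → x ≡ y
  x⊖y≡origin⇒x≡y []      []      _  = refl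
  x⊖y≡origin⇒x≡y (a ∷ x) (b ∷ y) eq =
    cong₂ _∷_ (x-y≡0⇒x≡y (proj₁ (∷-injective eq))) (x⊖y≡origin⇒x≡y x y (proj₂ (∷-injective eq)))

  Q-origin : ∀ k → Quadric.Q F (origin k) ≡ 0#
  Q-origin zero    = refl
  Q-origin (suc k) = begin
    - (0# * 0#) + origin k ∙ origin k   ≡⟨ cong₂ (λ u v → - u + v) (zeroˡ 0#) (origin-∙ (origin k)) ⟩
    - 0# + 0#                           ≡⟨ -‿inverseˡ 0# ⟩
    0#                                  ∎

module VectorSums {c ℓ₁ ℓ₂} {K : HeytingField c ℓ₁ ℓ₂} {f q} {F : FiniteField f q}
                  (ψ : AdditiveCharacter K F) (k : ℕ) where
  open AdditiveCharacter ψ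
  open CharacterSums ψ
  open ScalarField K
  private module F = FieldTheory F
  open VectorSpace F
  open FunctionSpace K F k
  open SetoidReasoning setoid

  private
    V : ℕ → Set f
    V = Vec F.Carrier

  sumVectors-cong : ∀ {j} {g h : V j → Carrier} → (∀ x → g x ≈ h x) → sumVectors g ≈ sumVectors h
  sumVectors-cong {zero}  g≈h = g≈h []
  sumVectors-cong {suc j} g≈h = Σ-cong λ a → sumVectors-cong λ x → g≈h (a ∷ x)

  sumVectors-*ˡ : ∀ {j} a (g : V j → Carrier) → sumVectors (λ x → a * g x) ≈ a * sumVectors g
  sumVectors-*ˡ {zero}  a g = refl
  sumVectors-*ˡ {suc j} a g = trans (Σ-cong λ b → sumVectors-*ˡ a (λ x → g (b ∷ x)))
                                    (Σ-*ˡ a λ b → sumVectors λ x → g (b ∷ x))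

  sumVectors-*ʳ : ∀ {j} (g : V j → Carrier) a → sumVectors (λ x → g x * a) ≈ sumVectors g * a
  sumVectors-*ʳ g a = trans (sumVectors-cong λ x → *-comm (g x) a)
                            (trans (sumVectors-*ˡ a g) (*-comm a (sumVectors g)))

  -- A diagonal quadratic form together with a linear form gives summands that factor in this way,
  -- which reduces sums over vectors to sums over single coordinates.
  sumVectors-product : ∀ {j} (g : F.Carrier → Carrier) (h : V j → Carrier) {gh : V (suc j) → Carrier} →
                       (∀ a x → gh (a ∷ x) ≈ g a * h x) → sumVectors gh ≈ Σ g * sumVectors h
  sumVectors-product g h {gh} eq = begin
    sumVectors gh                              ≈⟨ Σ-cong (λ a → sumVectors-cong (eq a)) ⟩
    Σ (λ a → sumVectors λ x → g a * h x)       ≈⟨ Σ-cong (λ a → sumVectors-*ˡ (g a) h) ⟩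
    Σ (λ a → g a * sumVectors h)               ≈⟨ Σ-*ʳ g (sumVectors h) ⟩
    Σ g * sumVectors h                         ∎

  sumVectors-single : ∀ {j} {g : V j → Carrier} a → (∀ x → x ≢ a → g x ≈ 0#) → sumVectors g ≈ g a
  sumVectors-single {zero}          []      g≈0 = refl
  sumVectors-single {suc j} {g} (b ∷ a) g≈0 = trans
    (Σ-single {λ c → sumVectors λ x → g (c ∷ x)} b λ c c≢b →
      trans (sumVectors-single {j} {λ x → g (c ∷ x)} a λ x _ → g≈0 (c ∷ x) (c≢b ∘ proj₁ ∘ ∷-injective))
            (g≈0 (c ∷ a) (c≢b ∘ proj₁ ∘ ∷-injective)))
    (sumVectors-single a λ x x≢a → g≈0 (b ∷ x) (x≢a ∘ proj₂ ∘ ∷-injective))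

  Σ-sumVectors-swap : ∀ {j} (g : F.Carrier → V j → Carrier) →
                      Σ (λ s → sumVectors (g s)) ≈ sumVectors (λ x → Σ λ s → g s x)
  Σ-sumVectors-swap {zero}  g = refl
  Σ-sumVectors-swap {suc j} g = trans
    (Σ-swap λ s a → sumVectors λ x → g s (a ∷ x))
    (Σ-cong λ a → Σ-sumVectors-swap λ s x → g s (a ∷ x))

  sumVectors-swap : ∀ {i j} (g : V i → V j → Carrier) →
                    sumVectors (λ x → sumVectors (g x)) ≈ sumVectors (λ y → sumVectors λ x → g x y)
  sumVectors-swap {zero}  g = refl
  sumVectors-swap {suc i} g = trans
    (Σ-cong λ a → sumVectors-swap λ x → g (a ∷ x))
    (Σ-sumVectors-swap λ a y → sumVectors λ x → g (a ∷ x) y)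

  sumVectors-reflect : ∀ {j} (x : V j) g → sumVectors (λ y → g (x ⊖ y)) ≈ sumVectors g
  sumVectors-reflect []      g = refl
  sumVectors-reflect (a ∷ x) g = trans
    (Σ-cong λ b → sumVectors-reflect x λ y → g ((a F.- b) ∷ y))
    (Σ-reindex (λ b → sumVectors λ y → g (b ∷ y)) (λ b → a F.- b) λ eq → F.-‿injective (F.+-cancelˡ a _ _ eq))

  sumVectors-1 : ∀ j → sumVectors {j} (λ _ → 1#) ≈ size ^ j
  sumVectors-1 zero    = refl
  sumVectors-1 (suc j) = trans
    (sumVectors-product {j} (λ _ → 1#) (λ _ → 1#) {λ _ → 1#} (λ _ _ → sym (*-identityˡ 1#)))
    (*-cong Σ1≈size (sumVectors-1 j))

  sum-character-origin : ∀ {j} (m : V j) → m ≡ origin j → sumVectors (λ x → χ (m ∙ x)) ≈ size ^ j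
  sum-character-origin {j} _ ≡.refl =
    trans (sumVectors-cong {j} λ x → trans (χ-cong (origin-∙ x)) χ-0) (sumVectors-1 j)

  sum-character≈0 : ∀ {j} (m : V j) → m ≢ origin j → sumVectors (λ x → χ (m ∙ x)) ≈ 0#
  sum-character≈0 []      m≢0 = contradiction ≡.refl m≢0
  sum-character≈0 (a ∷ m) m≢0 = trans
    (sumVectors-product (λ b → χ (a F.* b)) (λ x → χ (m ∙ x)) {λ x → χ ((a ∷ m) ∙ x)}
      (λ b x → χ-+ (a F.* b) (m ∙ x)))
    (factor (a F.≟ F.0#))
    where
    factor : Dec (a ≡ F.0#) → Σ (λ b → χ (a F.* b)) * sumVectors (λ x → χ (m ∙ x)) ≈ 0#
    factor (no a≢0)   = trans (*-congʳ (Σχ-scaled≈0 a≢0)) (zeroˡ _)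
    factor (yes a≡0) = trans (*-congˡ (sum-character≈0 m λ m≡0 → m≢0 (≡.cong₂ _∷_ a≡0 m≡0))) (zeroʳ _)

  orthogonality : ∀ {j} {x y : V j} → x ≢ y → sumVectors (λ m → χ (m ∙ x) * χ (F.- (m ∙ y))) ≈ 0#
  orthogonality {j} {x} {y} x≢y = trans
    (sumVectors-cong λ m → trans (sym (χ-+ _ _)) (χ-cong (≡.trans (≡.sym (∙-⊖ m x y)) (∙-comm m (x ⊖ y)))))
    (sum-character≈0 (x ⊖ y) (x≢y ∘ x⊖y≡origin⇒x≡y x y))

  normalisation : ∀ {j} (x : V j) → sumVectors (λ m → χ (m ∙ x) * χ (F.- (m ∙ x))) ≈ size ^ j
  normalisation {j} x = trans (sumVectors-cong λ m → χ-inverseʳ (m ∙ x)) (sumVectors-1 j)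

  -- Two biorthogonal kernels invert each other. Existence and uniqueness of Fourier coefficients
  -- both follow, with the kernels in opposite order.
  inversion : ∀ {j} (A B : V j → V j → Carrier) {N} →
              (∀ x y → x ≢ y → sumVectors (λ m → A x m * B m y) ≈ 0#) →
              (∀ x → sumVectors (λ m → A x m * B m x) ≈ N) →
              ∀ (h : V j → Carrier) y → sumVectors (λ m → sumVectors (λ x → h x * A x m) * B m y) ≈ h y * N
  inversion A B {N} off on h y = begin
    sumVectors (λ m → sumVectors (λ x → h x * A x m) * B m y)
      ≈⟨ sumVectors-cong (λ m → sumVectors-*ʳ (λ x → h x * A x m) (B m y)) ⟨
    sumVectors (λ m → sumVectors λ x → h x * A x m * B m y)
      ≈⟨ sumVectors-swap (λ m x → h x * A x m * B m y) ⟩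
    sumVectors (λ x → sumVectors λ m → h x * A x m * B m y)
      ≈⟨ sumVectors-cong (λ x → sumVectors-cong λ m → *-assoc (h x) (A x m) (B m y)) ⟩
    sumVectors (λ x → sumVectors λ m → h x * (A x m * B m y))
      ≈⟨ sumVectors-cong (λ x → sumVectors-*ˡ (h x) (λ m → A x m * B m y)) ⟩
    sumVectors (λ x → h x * sumVectors λ m → A x m * B m y)
      ≈⟨ sumVectors-single y (λ x x≢y → trans (*-congˡ (off x y x≢y)) (zeroʳ (h x))) ⟩
    h y * sumVectors (λ m → A y m * B m y)
      ≈⟨ *-congˡ (on y) ⟩
    h y * N
      ∎

  characters-basis : ∀ {u} → u * size ^ k ≈ 1# → IsBasis (λ m x → χ (m ∙ x))
  characters-basis {u} u*N≈1 g = coefficient , expansion , unique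
    where
    ĝ coefficient : V k → Carrier
    ĝ m = sumVectors λ y → g y * χ (F.- (m ∙ y))
    coefficient m = u * ĝ m
    cancel : ∀ z → u * (z * size ^ k) ≈ z
    cancel z = begin
      u * (z * size ^ k) ≈⟨ solve 3 (λ u z n → u :* (z :* n) := u :* n :* z) refl u z (size ^ k) ⟩
      u * size ^ k * z   ≈⟨ *-congʳ u*N≈1 ⟩
      1# * z             ≈⟨ *-identityˡ z ⟩
      z                  ∎
    expansion : IsExpansion (λ m x → χ (m ∙ x)) coefficient g
    expansion x = sym (begin
      sumVectors (λ m → u * ĝ m * χ (m ∙ x))
        ≈⟨ sumVectors-cong (λ m → *-assoc u (ĝ m) (χ (m ∙ x))) ⟩
      sumVectors (λ m → u * (ĝ m * χ (m ∙ x)))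
        ≈⟨ sumVectors-*ˡ u (λ m → ĝ m * χ (m ∙ x)) ⟩
      u * sumVectors (λ m → ĝ m * χ (m ∙ x))
        ≈⟨ *-congˡ (inversion (λ y m → χ (F.- (m ∙ y))) (λ m x → χ (m ∙ x))
             (λ y x y≢x → trans (sumVectors-cong λ m → *-comm (χ (F.- (m ∙ y))) (χ (m ∙ x)))
                                (orthogonality (y≢x ∘ ≡.sym)))
             (λ x → trans (sumVectors-cong λ m → *-comm (χ (F.- (m ∙ x))) (χ (m ∙ x))) (normalisation x)) g x) ⟩
      u * (g x * size ^ k)
        ≈⟨ cancel (g x) ⟩
      g x
        ∎)
    -- Orthogonality sums over the index of the characters, uniqueness over their argument; the
    -- symmetry of `_∙_` exchanges the two.
    transpose : ∀ (l m y : V k) → χ (l ∙ y) * χ (F.- (m ∙ y)) ≈ χ (y ∙ l) * χ (F.- (y ∙ m))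
    transpose l m y = *-cong (χ-cong (∙-comm l y)) (χ-cong (≡.cong F.-_ (∙-comm m y)))
    unique : ∀ b → IsExpansion (λ m x → χ (m ∙ x)) b g → ∀ m → coefficient m ≈ b m
    unique b b-expands m = begin
      u * ĝ m
        ≈⟨ *-congˡ (sumVectors-cong λ y → *-congʳ (b-expands y)) ⟩
      u * sumVectors (λ y → sumVectors (λ l → b l * χ (l ∙ y)) * χ (F.- (m ∙ y)))
        ≈⟨ *-congˡ (inversion (λ l y → χ (l ∙ y)) (λ y m → χ (F.- (m ∙ y)))
             (λ l m l≢m → trans (sumVectors-cong (transpose l m)) (orthogonality l≢m))
             (λ l → trans (sumVectors-cong (transpose l l)) (normalisation l)) b m) ⟩
      u * (b m * size ^ k)
        ≈⟨ cancel (b m) ⟩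
      b m
        ∎

  -- For any connection set, `c = x ⊖ y` splits `χ (m ∙ y)` into `χ (m ∙ x)` and `χ (F.- (m ∙ c))`,
  -- and only the second factor is summed. The value 1 at the origin shows that the function is
  -- nonzero.
  characters-eigenvectors : ∀ {s} {S : Pred (V k) s} (S? : Decidable S) m →
    IsEigenvector (adjacencyOperator (CayleyGraph.adjacent? F k S S?))
                  (sumOver S? λ c → χ (F.- (m ∙ c))) (λ x → χ (m ∙ x))
  characters-eigenvectors S? m = (origin k , #-congʳ (sym (trans (χ-cong (∙-origin m)) χ-0)) 1#0) , λ x → begin
    sumVectors (λ y → if does (S? (x ⊖ y)) then χ (m ∙ y) else 0#)
      -- Writing `y` as `x ⊖ (x ⊖ y)` makes the summand a function of `x ⊖ y` alone, ready for
      -- reflection.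
      ≈⟨ sumVectors-cong (λ y → reflexive
           (≡.cong (λ z → if does (S? (x ⊖ y)) then χ (m ∙ z) else 0#) (≡.sym (⊖-involutive x y)))) ⟩
    sumVectors (λ y → if does (S? (x ⊖ y)) then χ (m ∙ (x ⊖ (x ⊖ y))) else 0#)
      ≈⟨ sumVectors-reflect x (λ c → if does (S? c) then χ (m ∙ (x ⊖ c)) else 0#) ⟩
    sumVectors (λ c → if does (S? c) then χ (m ∙ (x ⊖ c)) else 0#)
      ≈⟨ sumVectors-cong (λ c → factor x c (S? c)) ⟩
    sumVectors (λ c → (if does (S? c) then χ (F.- (m ∙ c)) else 0#) * χ (m ∙ x))
      ≈⟨ sumVectors-*ʳ (λ c → if does (S? c) then χ (F.- (m ∙ c)) else 0#) (χ (m ∙ x)) ⟩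
    sumVectors (λ c → if does (S? c) then χ (F.- (m ∙ c)) else 0#) * χ (m ∙ x)
      ∎
    where
    open HeytingProperties heytingCommutativeRing using (#-congʳ; 1#0)
    factor : ∀ x c {p} {P : Set p} (d : Dec P) →
             (if does d then χ (m ∙ (x ⊖ c)) else 0#) ≈ (if does d then χ (F.- (m ∙ c)) else 0#) * χ (m ∙ x)
    factor x c (yes _) = trans (χ-cong (∙-⊖ m x c)) (trans (χ-difference _ _) (*-comm _ _))
    factor x c (no _)  = sym (zeroˡ _)

-- Exponential sums over the quadric

module QuadricSums {c ℓ₁ ℓ₂} {K : HeytingField c ℓ₁ ℓ₂} {f q} {F : FiniteField f q}
                   (ψ : AdditiveCharacter K F) (q%4≡3 : q % 4 ≡ 3) (k : ℕ) where
  open AdditiveCharacter ψ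
  open CharacterSums ψ
  open OddSize q%4≡3
  open VectorSums ψ k
  open ScalarField K
  private module F = FieldTheory F
  open ThreeModFour F q%4≡3 using (x+x≡0⇒x≡0)
  open VectorSpace F
  open Quadric F
  open FunctionSpace K F k
  open SetoidReasoning setoid

  4F : F.Carrier
  4F = F.1# F.+ F.1# F.+ (F.1# F.+ F.1#)

  4F≢0 : 4F ≢ F.0#
  4F≢0 = F.0≢1 ∘ ≡.sym ∘ x+x≡0⇒x≡0 ∘ x+x≡0⇒x≡0

  -- Kept as a product, so that `s` enters only through `F.inv s` and a sum over `s` can be
  -- reindexed by `F.inv`. At `s = 0` it takes the value 0.
  inv[4_] : F.Carrier → F.Carrier
  inv[4 s ] = F.inv 4F F.* F.inv s

  4s*inv[4s]≡1 : ∀ {s} → s ≢ F.0# → (s F.+ s F.+ (s F.+ s)) F.* inv[4 s ] ≡ F.1#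
  4s*inv[4s]≡1 {s} s≢0 = ≡.trans
    (F.solve 3 (λ s i j → (s F.:+ s F.:+ (s F.:+ s)) F.:* (i F.:* j) F.:=
        (F.con (ℤ.+ 1) F.:+ F.con (ℤ.+ 1) F.:+ (F.con (ℤ.+ 1) F.:+ F.con (ℤ.+ 1))) F.:* i F.:* (s F.:* j))
      ≡.refl s (F.inv 4F) (F.inv s))
    (≡.trans (≡.cong₂ F._*_ (F.inv-inverseʳ 4F≢0) (F.inv-inverseʳ s≢0)) (F.*-identityˡ F.1#))

  interchange : ∀ x g y h → (x * g) * (y * h) ≈ (x * y) * (g * h)
  interchange = solve 4 (λ x g y h → (x :* g) :* (y :* h) := (x :* y) :* (g :* h)) refl

  completeSquares : ∀ {s w} → (s F.+ s F.+ (s F.+ s)) F.* w ≡ F.1# → ∀ {j} (m : Vec F.Carrier j) →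
    sumVectors (λ x → χ (s F.* (x ∙ x) F.- m ∙ x)) ≈ χ (F.- (w F.* (m ∙ m))) * gauss s ^ j
  completeSquares {s} {w} 4sw≡1 [] = begin
    χ (s F.* F.0# F.- F.0#)       ≈⟨ χ-cong (F.solve 2 (λ s w → s F.:* o F.:- o F.:= F.:- (w F.:* o)) ≡.refl s w) ⟩
    χ (F.- (w F.* F.0#))          ≈⟨ *-identityʳ _ ⟨
    χ (F.- (w F.* F.0#)) * 1#     ∎
    where
    o : ∀ {n} → F.Polynomial n
    o = F.con (ℤ.+ 0)
  completeSquares {s} {w} 4sw≡1 {suc j} (b ∷ m) = begin
    sumVectors (λ x → χ (s F.* (x ∙ x) F.- (b ∷ m) ∙ x))
      ≈⟨ sumVectors-product (λ a → χ (s F.* (a F.* a) F.- b F.* a)) (λ x → χ (s F.* (x ∙ x) F.- m ∙ x))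
           {λ x → χ (s F.* (x ∙ x) F.- (b ∷ m) ∙ x)}
           (λ a x → trans (χ-cong (split s b a (x ∙ x) (m ∙ x))) (χ-+ _ _)) ⟩
    Σ (λ a → χ (s F.* (a F.* a) F.- b F.* a)) * sumVectors (λ x → χ (s F.* (x ∙ x) F.- m ∙ x))
      ≈⟨ *-cong (completeSquare b 4sw≡1) (completeSquares {s} {w} 4sw≡1 m) ⟩
    (χ (F.- (w F.* (b F.* b))) * gauss s) * (χ (F.- (w F.* (m ∙ m))) * gauss s ^ j)
      ≈⟨ interchange _ _ _ _ ⟩
    (χ (F.- (w F.* (b F.* b))) * χ (F.- (w F.* (m ∙ m)))) * (gauss s * gauss s ^ j)
      ≈⟨ *-congʳ (trans (sym (χ-+ _ _)) (χ-cong (join w (b F.* b) (m ∙ m)))) ⟩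
    χ (F.- (w F.* ((b ∷ m) ∙ (b ∷ m)))) * gauss s ^ suc j
      ∎
    where
    split : ∀ s b a xx mx → s F.* (a F.* a F.+ xx) F.- (b F.* a F.+ mx) ≡
                            (s F.* (a F.* a) F.- b F.* a) F.+ (s F.* xx F.- mx)
    split = F.solve 5 (λ s b a xx mx → s F.:* (a F.:* a F.:+ xx) F.:- (b F.:* a F.:+ mx) F.:=
                            (s F.:* (a F.:* a) F.:- b F.:* a) F.:+ (s F.:* xx F.:- mx)) ≡.refl
    join : ∀ w u v → F.- (w F.* u) F.+ F.- (w F.* v) ≡ F.- (w F.* (u F.+ v))
    join = F.solve 3 (λ w u v → F.:- (w F.:* u) F.:+ F.:- (w F.:* v) F.:= F.:- (w F.:* (u F.:+ v))) ≡.refl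

  -- The two characters are kept apart: summed over `s`, the first one detects `Q x = 0`.
  twistedSum : ∀ {j} → Vec F.Carrier j → F.Carrier → Carrier
  twistedSum m s = sumVectors λ x → χ (Q x F.* s) * χ (F.- (m ∙ x))

  twistedSum-0 : ∀ {j} (m : Vec F.Carrier j) → twistedSum m F.0# ≈ sumVectors λ x → χ (m ∙ x)
  twistedSum-0 {j} m = begin
    sumVectors (λ x → χ (Q x F.* F.0#) * χ (F.- (m ∙ x)))
      ≈⟨ sumVectors-cong {j} (λ x → trans (*-congʳ (trans (χ-cong (F.zeroʳ (Q x))) χ-0)) (*-identityˡ _)) ⟩
    sumVectors (λ x → χ (F.- (m ∙ x)))
      -- The substitution of `- x` for `x` is the reflection `origin j ⊖ x`.
      ≈⟨ sumVectors-cong {j} (λ x → χ-cong (negate x)) ⟩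
    sumVectors (λ x → χ (m ∙ (origin j ⊖ x)))
      ≈⟨ sumVectors-reflect (origin j) (λ x → χ (m ∙ x)) ⟩
    sumVectors (λ x → χ (m ∙ x))
      ∎
    where
    negate : ∀ x → F.- (m ∙ x) ≡ m ∙ (origin j ⊖ x)
    negate x = ≡.sym (≡.trans (∙-⊖ m (origin j) x) (≡.trans (≡.cong (F._- m ∙ x) (∙-origin m)) (F.+-identityˡ _)))

  -- The overall sign comes from the first coordinate: there `Q` has coefficient `- 1`, so the
  -- square is completed with `- s` and `- w`, and `gauss (- s) = - gauss s`.
  twistedSum-≢0 : ∀ {j s} → s ≢ F.0# → (m : Vec F.Carrier (suc j)) →
                  twistedSum m s ≈ - (χ (F.- (inv[4 s ] F.* Q m)) * gauss s ^ suc j)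
  twistedSum-≢0 {j} {s} s≢0 (b ∷ m) = begin
    twistedSum (b ∷ m) s
      ≈⟨ sumVectors-product (λ a → χ (F.- s F.* (a F.* a) F.- b F.* a)) (λ x → χ (s F.* (x ∙ x) F.- m ∙ x))
           {λ x → χ (Q x F.* s) * χ (F.- ((b ∷ m) ∙ x))}
           (λ a x → trans (sym (χ-+ _ _)) (trans (χ-cong (split s b a (x ∙ x) (m ∙ x))) (χ-+ _ _))) ⟩
    Σ (λ a → χ (F.- s F.* (a F.* a) F.- b F.* a)) * sumVectors (λ x → χ (s F.* (x ∙ x) F.- m ∙ x))
      ≈⟨ *-cong (completeSquare b -4sw≡1) (completeSquares (4s*inv[4s]≡1 s≢0) m) ⟩
    (χ (F.- (F.- w F.* (b F.* b))) * gauss (F.- s)) * (χ (F.- (w F.* (m ∙ m))) * gauss s ^ j)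
      ≈⟨ interchange _ _ _ _ ⟩
    (χ (F.- (F.- w F.* (b F.* b))) * χ (F.- (w F.* (m ∙ m)))) * (gauss (F.- s) * gauss s ^ j)
      ≈⟨ *-cong (trans (sym (χ-+ _ _)) (χ-cong (join w (b F.* b) (m ∙ m)))) (*-congʳ (gauss-neg s≢0)) ⟩
    χ (F.- (w F.* Q (b ∷ m))) * (- gauss s * gauss s ^ j)
      ≈⟨ pull _ _ _ ⟩
    - (χ (F.- (w F.* Q (b ∷ m))) * gauss s ^ suc j)
      ∎
    where
    w = inv[4 s ]
    -4sw≡1 : (F.- s F.+ F.- s F.+ (F.- s F.+ F.- s)) F.* F.- w ≡ F.1#
    -4sw≡1 = ≡.trans (F.solve 2 (λ s w → (F.:- s F.:+ F.:- s F.:+ (F.:- s F.:+ F.:- s)) F.:* F.:- w F.:=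
                                         (s F.:+ s F.:+ (s F.:+ s)) F.:* w) ≡.refl s w)
                     (4s*inv[4s]≡1 s≢0)
    split : ∀ s b a xx mx → (F.- (a F.* a) F.+ xx) F.* s F.+ F.- (b F.* a F.+ mx) ≡
                            (F.- s F.* (a F.* a) F.- b F.* a) F.+ (s F.* xx F.- mx)
    split = F.solve 5 (λ s b a xx mx → (F.:- (a F.:* a) F.:+ xx) F.:* s F.:+ F.:- (b F.:* a F.:+ mx) F.:=
                            (F.:- s F.:* (a F.:* a) F.:- b F.:* a) F.:+ (s F.:* xx F.:- mx)) ≡.refl
    join : ∀ w u v → F.- (F.- w F.* u) F.+ F.- (w F.* v) ≡ F.- (w F.* (F.- u F.+ v))
    join = F.solve 3 (λ w u v → F.:- (F.:- w F.:* u) F.:+ F.:- (w F.:* v) F.:= F.:- (w F.:* (F.:- u F.:+ v))) ≡.refl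
    pull : ∀ x g h → x * (- g * h) ≈ - (x * (g * h))
    pull = solve 3 (λ x g h → x :* (:- g :* h) := :- (x :* (g :* h))) refl

  size*indicator : ∀ {a v} (a≡0? : Dec (a ≡ F.0#)) →
                   size * (if does a≡0? then v else 0#) ≈ Σ (λ s → χ (a F.* s)) * v
  size*indicator (yes a≡0) = *-congʳ (sym (Σχ-zero a≡0))
  size*indicator (no a≢0)  = trans (zeroʳ size) (sym (trans (*-congʳ (Σχ-scaled≈0 a≢0)) (zeroˡ _)))

  eigenvalue : Vec F.Carrier k → Carrier
  eigenvalue m = sumOver (C? k) λ x → χ (F.- (m ∙ x))

  size*eigenvalue : ∀ m → size * eigenvalue m ≈ Σ (twistedSum m)
  size*eigenvalue m = begin
    size * eigenvalue m
      ≈⟨ sumVectors-*ˡ size (λ x → if does (C? k x) then χ (F.- (m ∙ x)) else 0#) ⟨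
    sumVectors (λ x → size * (if does (C? k x) then χ (F.- (m ∙ x)) else 0#))
      ≈⟨ sumVectors-cong (λ x → size*indicator (C? k x)) ⟩
    sumVectors (λ x → Σ (λ s → χ (Q x F.* s)) * χ (F.- (m ∙ x)))
      ≈⟨ sumVectors-cong (λ x → Σ-*ʳ (λ s → χ (Q x F.* s)) (χ (F.- (m ∙ x)))) ⟨
    sumVectors (λ x → Σ λ s → χ (Q x F.* s) * χ (F.- (m ∙ x)))
      ≈⟨ Σ-sumVectors-swap (λ s x → χ (Q x F.* s) * χ (F.- (m ∙ x))) ⟨
    Σ (twistedSum m)
      ∎

  module Evaluation (i : ℕ) (k≡ : k ≡ suc i ℕ.* 4) (m : Vec F.Carrier k) where

    -- As `k` is `4(i + 1)`, this is `q ^ (k / 2)`, the value of `gauss s ^ k` for every nonzero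
    -- `s`.
    N : Carrier
    N = size ^ (suc i ℕ.* 2)

    -- The phase left after completing all squares. At `s = 0` the totalised inverse gives it the
    -- value 1, which is the source of the lone `N` in `size*eigenvalue+`.
    dual : F.Carrier → Carrier
    dual s = χ (F.- (inv[4 s ] F.* Q m))

    twistedSum+N*dual≈0 : ∀ s → s ≢ F.0# → twistedSum m s + N * dual s ≈ 0#
    twistedSum+N*dual≈0 s s≢0 = begin
      twistedSum m s + N * dual s                          ≈⟨ +-congʳ (evaluate k≡ m) ⟩
      - (dual s * gauss s ^ (suc i ℕ.* 4)) + N * dual s    ≈⟨ +-congʳ (-‿cong (*-congˡ (gauss-power s≢0 (suc i)))) ⟩
      - (dual s * N) + N * dual s                          ≈⟨ +-congʳ (-‿cong (*-comm _ _)) ⟩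
      - (N * dual s) + N * dual s                          ≈⟨ -‿inverseˡ _ ⟩
      0#                                                   ∎
      where
      -- The dimension is generalised so that its equation can be matched, which exposes a first
      -- coordinate of `m`.
      evaluate : ∀ {k} → k ≡ suc i ℕ.* 4 → (m : Vec F.Carrier k) →
                 twistedSum m s ≈ - (χ (F.- (inv[4 s ] F.* Q m)) * gauss s ^ (suc i ℕ.* 4))
      evaluate ≡.refl m = twistedSum-≢0 s≢0 m

    dual-0 : dual F.0# ≈ 1#
    dual-0 = trans (χ-cong (≡.trans (≡.cong (λ v → F.- (F.inv 4F F.* v F.* Q m)) F.inv-0)
      (F.solve 2 (λ v x → F.:- (v F.:* F.con (ℤ.+ 0) F.:* x) F.:= F.con (ℤ.+ 0)) ≡.refl (F.inv 4F) (Q m)))) χ-0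

    -- Adding N * dual s to the s-th summand of q λ leaves only s = 0.
    size*eigenvalue+ : size * eigenvalue m + N * Σ dual ≈ sumVectors (λ x → χ (m ∙ x)) + N
    size*eigenvalue+ = begin
      size * eigenvalue m + N * Σ dual              ≈⟨ +-cong (size*eigenvalue m) (sym (Σ-*ˡ N dual)) ⟩
      Σ (twistedSum m) + Σ (λ s → N * dual s)       ≈⟨ Σ-distrib-+ (twistedSum m) (λ s → N * dual s) ⟨
      Σ (λ s → twistedSum m s + N * dual s)         ≈⟨ Σ-single F.0# twistedSum+N*dual≈0 ⟩
      twistedSum m F.0# + N * dual F.0#             ≈⟨ +-cong (twistedSum-0 m) (trans (*-congˡ dual-0) (*-identityʳ N)) ⟩
      sumVectors (λ x → χ (m ∙ x)) + N              ∎

    -- Inversion permutes the whole field, zero included, so `1/s` may be replaced by `s`; what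
    -- remains is the sum of a character of `s`.
    Σdual≈ : Σ dual ≈ Σ (λ s → χ (F.- (F.inv 4F F.* Q m) F.* s))
    Σdual≈ = begin
      Σ dual
        ≈⟨ Σ-cong (λ s → χ-cong (rearrange (F.inv s))) ⟩
      Σ (λ s → χ (F.- (F.inv 4F F.* Q m) F.* F.inv s))
        ≈⟨ Σ-reindex (λ s → χ (F.- (F.inv 4F F.* Q m) F.* s)) F.inv F.inv-injective ⟩
      Σ (λ s → χ (F.- (F.inv 4F F.* Q m) F.* s))
        ∎
      where
      rearrange : ∀ t → F.- (F.inv 4F F.* t F.* Q m) ≡ F.- (F.inv 4F F.* Q m) F.* t
      rearrange t = F.solve 3 (λ v t x → F.:- (v F.:* t F.:* x) F.:= F.:- (v F.:* x) F.:* t) ≡.refl (F.inv 4F) t (Q m)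

    Σdual-isotropic : C k m → Σ dual ≈ size
    Σdual-isotropic Qm≡0 = trans Σdual≈ (Σχ-zero (≡.trans (≡.cong (λ x → F.- (F.inv 4F F.* x)) Qm≡0)
      (≡.trans (≡.cong F.-_ (F.zeroʳ _)) F.-0#≈0#)))

    Σdual-anisotropic : ¬ C k m → Σ dual ≈ 0#
    Σdual-anisotropic Qm≢0 = trans Σdual≈ (Σχ-scaled≈0 λ eq → F.x*y≢0 inv4≢0 Qm≢0
      (F.-‿injective (≡.trans eq (≡.sym F.-0#≈0#))))
      where
      inv4≢0 : F.inv 4F ≢ F.0#
      inv4≢0 inv4≡0 = 4F≢0 (F.inv-injective (≡.trans inv4≡0 (≡.sym F.inv-0)))

    sum-character : ∀ (m≡0? : Dec (m ≡ origin k)) →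
                    sumVectors (λ x → χ (m ∙ x)) ≈ size ^ k * (if does m≡0? then 1# else 0#)
    sum-character (yes m≡0) = trans (sum-character-origin m m≡0) (sym (*-identityʳ _))
    sum-character (no m≢0)  = trans (sum-character≈0 m m≢0) (sym (zeroʳ _))

    size^k≈N*N : size ^ k ≈ N * N
    size^k≈N*N = trans (reflexive (≡.cong (size ^_) (≡.trans k≡ (≡.trans (≡.sym (ℕ.*-assoc (suc i) 2 2))
        (≡.trans (ℕ.*-comm (suc i ℕ.* 2) 2) (≡.cong (suc i ℕ.* 2 ℕ.+_) (ℕ.+-identityʳ _)))))))
      (^-homo-* size (suc i ℕ.* 2) (suc i ℕ.* 2))

    module _ {u : Carrier} (u*size≈1 : u * size ≈ 1#) where
      private
        -- This is `q ^ (- k / 2)`, the inverse of `N`.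
        b : Carrier
        b = u ^ (suc i ℕ.* 2)

      N*b≈1 : N * b ≈ 1#
      N*b≈1 = begin
        N * b                           ≈⟨ ^-distrib-* size u (suc i ℕ.* 2) ⟨
        (size * u) ^ (suc i ℕ.* 2)      ≈⟨ ^-congˡ (suc i ℕ.* 2) (trans (*-comm size u) u*size≈1) ⟩
        1# ^ (suc i ℕ.* 2)              ≈⟨ 1^n≈1 (suc i ℕ.* 2) ⟩
        1#                              ∎

      -- The unknown `e` stands for `Σ dual`, which is `size` or `0#` according to whether `m` is
      -- isotropic.
      solveFor : ∀ {l e} → size * l + N * e ≈ sumVectors (λ x → χ (m ∙ x)) + N → ∀ (m≡0? : Dec (m ≡ origin k)) →
                 l ≈ size ^ k * ((u * (if does m≡0? then 1# else 0#) - u * e * b) + u * b)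
      solveFor {l} {e} eq m≡0? = begin
        l
          ≈⟨ *-identityˡ l ⟨
        1# * l
          ≈⟨ *-congʳ u*size≈1 ⟨
        u * size * l
          ≈⟨ isolate u size l (N * e) ⟩
        u * (size * l + N * e) - u * (N * e)
          ≈⟨ +-congʳ (*-congˡ (trans eq (+-congʳ (trans (sum-character m≡0?) (*-congʳ size^k≈N*N))))) ⟩
        u * (N * N * δ + N) - u * (N * e)
          -- The factors `1#` are inserted to become `N * b`, after which every term contains
          -- `N * N`, that is `size ^ k`.
          ≈⟨ collect u N δ e ⟩
        N * N * (u * δ) + 1# * (N * u) - 1# * (N * (u * e))
          ≈⟨ +-cong (+-congˡ (*-congʳ N*b≈1)) (-‿cong (*-congʳ N*b≈1)) ⟨
        N * N * (u * δ) + N * b * (N * u) - N * b * (N * (u * e))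
          ≈⟨ factor u N δ e b ⟩
        N * N * ((u * δ - u * e * b) + u * b)
          ≈⟨ *-congʳ size^k≈N*N ⟨
        size ^ k * ((u * δ - u * e * b) + u * b)
          ∎
        where
        δ = if does m≡0? then 1# else 0#
        isolate : ∀ u q l x → u * q * l ≈ u * (q * l + x) - u * x
        isolate = solve 4 (λ u q l x → u :* q :* l := u :* (q :* l :+ x) :- u :* x) refl
        collect : ∀ u n d e → u * (n * n * d + n) - u * (n * e) ≈
                              n * n * (u * d) + 1# * (n * u) - 1# * (n * (u * e))
        collect = solve 4 (λ u n d e → u :* (n :* n :* d :+ n) :- u :* (n :* e) :=
          n :* n :* (u :* d) :+ con (ℤ.+ 1) :* (n :* u) :- con (ℤ.+ 1) :* (n :* (u :* e))) refl
        factor : ∀ u n d e b → n * n * (u * d) + n * b * (n * u) - n * b * (n * (u * e)) ≈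
                               n * n * ((u * d - u * e * b) + u * b)
        factor = solve 5 (λ u n d e b → n :* n :* (u :* d) :+ n :* b :* (n :* u) :- n :* b :* (n :* (u :* e)) :=
          n :* n :* ((u :* d :- u :* e :* b) :+ u :* b)) refl

      eigenvalue-isotropic : C k m → ∀ (m≡0? : Dec (m ≡ origin k)) →
        eigenvalue m ≈ size ^ k * ((u * (if does m≡0? then 1# else 0#) - b) + u * b)
      eigenvalue-isotropic Qm≡0 m≡0? = trans (solveFor size*eigenvalue+ m≡0?)
        (*-congˡ (+-congʳ (+-congˡ (-‿cong (begin
          u * Σ dual * b   ≈⟨ *-congʳ (*-congˡ (Σdual-isotropic Qm≡0)) ⟩
          u * size * b     ≈⟨ *-congʳ u*size≈1 ⟩
          1# * b           ≈⟨ *-identityˡ b ⟩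
          b                ∎)))))

      eigenvalue-anisotropic : ¬ C k m → eigenvalue m ≈ size ^ k * (u * b)
      -- The origin lies on the quadric, so `m` is not the origin and the delta term is absent.
      eigenvalue-anisotropic Qm≢0 = trans (solveFor size*eigenvalue+ (no m≢0)) (*-congˡ (begin
        (u * 0# - u * Σ dual * b) + u * b   ≈⟨ +-congʳ (+-congˡ (-‿cong (*-congʳ (*-congˡ (Σdual-anisotropic Qm≢0))))) ⟩
        (u * 0# - u * 0# * b) + u * b       ≈⟨ drop u b ⟩
        u * b                               ∎))
        where
        m≢0 : m ≢ origin k
        m≢0 m≡0 = Qm≢0 (≡.trans (≡.cong Q m≡0) (Q-origin k))
        drop : ∀ u b → (u * 0# - u * 0# * b) + u * b ≈ u * b
        drop = solve 2 (λ u b → (u :* con (ℤ.+ 0) :- u :* con (ℤ.+ 0) :* b) :+ u :* b := u :* b) refl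

theorem1p6 : ∀ {c ℓ₁ ℓ₂ f}
    (K : HeytingField c ℓ₁ ℓ₂) (charZero : CharacteristicZero K)
    (p n q k : ℕ) (ζ : HeytingField.Carrier K) (F : FiniteField f q) →
    Prime p → p ≢ 2 → 1 ℕ.≤ n → q ≡ p ℕ.^ n → q % 4 ≡ 3 →
    1 ℕ.≤ k → k % 4 ≡ 0 →
    IsPrimitiveRootOfUnity K p ζ →
    let open Spectrum K charZero ζ F p n k in
    (∀ m → IsEigenvector adjacency (eigenvalue m) (character m)) ×
    IsBasis character ×
    (∀ m →
    (Cₖ m →
    eigenvalue m ≈ qᴷ ^ k * ((q⁻¹ * δ₀ m - q⁻¹ ^ (k / 2)) + q⁻¹ ^ ((k ℕ.+ 2) / 2))) ×
    (¬ Cₖ m →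
    eigenvalue m ≈ qᴷ ^ k * q⁻¹ ^ ((k ℕ.+ 2) / 2)))
theorem1p6 K charZero p n q k ζ F p-prime p≢2 1≤n q≡p^n q%4≡3 1≤k k%4≡0 ζ-primitive
  -- The quotient is at least 1 since `k` is positive; its predecessor `i` parametrises the
  -- evaluation.
  with k / 4 | ≡.trans (m≡m%n+[m/n]*n k 4) (≡.cong (ℕ._+ k / 4 ℕ.* 4) k%4≡0)
... | zero  | k≡0 = contradiction k≡0 (ℕ.n>0⇒n≢0 1≤k)
... | suc i | k≡4[1+i] =
  characters-eigenvectors (Quadric.C? F k) ,
  characters-basis q⁻ᵏqᵏ≈1 ,
  λ m →
    (λ Qm≡0 → ≡.subst₂
      (λ h h′ → eigenvalue m ≈ qᴷ ^ k * ((q⁻¹ * δ₀ m - q⁻¹ ^ h) + q⁻¹ ^ h′)) (≡.sym k/2≡) (≡.sym [k+2]/2≡)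
      (Evaluation.eigenvalue-isotropic i k≡4[1+i] m q⁻¹q≈1 Qm≡0 (Space._≟ᵛ_ F k m (Space.origin F k)))) ,
    (λ Qm≢0 → ≡.subst
      (λ h → eigenvalue m ≈ qᴷ ^ k * q⁻¹ ^ h) (≡.sym [k+2]/2≡)
      (Evaluation.eigenvalue-anisotropic i k≡4[1+i] m q⁻¹q≈1 Qm≢0))
  where
  open Spectrum K charZero ζ F p n k
  open CanonicalCharacterProperties K ζ F p n p-prime 1≤n q≡p^n ζ-primitive
  ψ : AdditiveCharacter K F
  ψ = record { χ-+ = χ-+ ; χ-0 = χ-0 ; χ-nontrivial = χ-nontrivial }
  open VectorSums ψ k
  open QuadricSums ψ q%4≡3 k using (module Evaluation)
  open ScalarField K using (trans; sym; 1#; 1^n≈1; ^-congˡ; ^-distrib-*; reciprocal-inverseˡ)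
  q⁻¹q≈1 : q⁻¹ * qᴷ ≈ 1#
  q⁻¹q≈1 = reciprocal-inverseˡ qᴷ (charZero q {{FiniteField.size-nonZero F}})
  q⁻ᵏqᵏ≈1 : q⁻¹ ^ k * qᴷ ^ k ≈ 1#
  q⁻ᵏqᵏ≈1 = trans (sym (^-distrib-* q⁻¹ qᴷ k)) (trans (^-congˡ k q⁻¹q≈1) (1^n≈1 k))
  2[1+i]*2≡k : suc i ℕ.* 2 ℕ.* 2 ≡ k
  2[1+i]*2≡k = ≡.trans (ℕ.*-assoc (suc i) 2 2) (≡.sym k≡4[1+i])
  k/2≡ : k / 2 ≡ suc i ℕ.* 2
  k/2≡ = ≡.trans (≡.cong (_/ 2) (≡.sym 2[1+i]*2≡k)) (m*n/n≡m (suc i ℕ.* 2) 2)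
  -- The exponent is the successor of `k / 2`, so this power of `q⁻¹` unfolds to `q⁻¹` times the
  -- power with exponent `k / 2`, as in the evaluation.
  [k+2]/2≡ : (k ℕ.+ 2) / 2 ≡ suc (suc i ℕ.* 2)
  [k+2]/2≡ = ≡.trans (≡.cong (_/ 2) (≡.trans (ℕ.+-comm k 2) (≡.cong (2 ℕ.+_) (≡.sym 2[1+i]*2≡k))))
    (m*n/n≡m (suc (suc i ℕ.* 2)) 2)
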